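{- Let $R_{10}=\frac12\,\mathrm{circulant}(J,O,O,O,Y)$ with $2\times2$ blocks $J$, $O$, $Y=2I-J$. Consider on $\mathcal{B}_{R_{10}}$ the equivalence relation generated by: - complementation $B\mapsto J-I-B$ (with $J,I$ of order $10$); - replacing an off-diagonal $2\times 2$ block $B_{ij}$ ($i\ne j$), together with its transpose $B_{ji}$, by the complements $J-B_{ij}$ and $J-B_{ji}$; - conjugation $B\mapsto P^TBP$, where $P$ is a permutation matrix for which there exists a permutation matrix $P'$ with $P^TR_{10}P'=R_{10}$. Then $\mathcal{B}_{R_{10}}$ has exactly three matrices irreducible with respect to $R_{10}$ up to this equivalence. They are represented by $$\mathrm{circulant}(O,O,N,N^T,O),\qquad \mathrm{circulant}(O,I,N,N^T,I),\qquad \mathrm{circulant}(O,N,N^T,N,N^T),$$ where $N=\begin{bmatrix} 0&0 \\ 1&1 \end{bmatrix}$ and $I,O$ are of order $2$.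
   Context: $\mathrm{circulant}(X_1,\dots,X_m)$ with $2\times2$ blocks $X_k$ denotes the block matrix with block $X_k$ in block position $(i,i+k-1)$, block indices read modulo $m$. $I$ is the identity matrix, $J$ the all-ones matrix and $O$ the zero matrix. An adjacency matrix is a symmetric $01$-matrix with zero diagonal. An orthogonal matrix is regular if each of its rows sums to $1$. The level of a rational matrix is the smallest positive integer $\ell$ such that $\ell$ times the matrix is integral. A matrix is decomposable if it can be written as a non-trivial block-diagonal matrix after some permutation of its rows and columns (rows and columns may be permuted independently), and indecomposable otherwise. For a regular orthogonal matrix $R$, $\mathcal{V}_R$ is the set of $01$-vectors $v$ such that $R^Tv$ is again a $01$-vector, and $\mathcal{B}_R$ is the set of adjacency matrices $B$ such that $R^TBR$ is again an adjacency matrix. Reducibility: let $R$ be an indecomposable regular orthogonal matrix of level $2$ and let $B\in\mathcal{B}_R$. Then $B$ is reducible with respect to $R$ if there are decomposable regular orthogonal matrices $R_1,\dots,R_s$ of the same order as $R$, each of level at most $2$ (in particular $R_i$ may have the form $\mathrm{diag}(R_i',I)$ with $R_i'$ a smaller regular orthogonal matrix, and may have several non-trivial blocks), such that $R=R_1\cdots R_s$ and such that for every $i<s$ and every adjacency matrix $A=\begin{bmatrix} B&V \\ V^T&W \end{bmatrix}$ all of whose columns of $V$ lie in $\mathcal{V}_R$, the matrix $(Q_1\cdots Q_i)^TA(Q_1\cdots Q_i)$ is an adjacency matrix, where $Q_k=\begin{bmatrix} R_k&O \\ O&I \end{bmatrix}$. Otherwise $B$ is irreducible with respect to $R$. -}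

module Defs where

open import Data.Bool.Base using (Bool; if_then_else_; _∧_; _∨_)
open import Data.Fin.Base using (Fin; zero; suc; toℕ; quotient; remainder)
open import Data.Fin.Permutation using (Permutation′; _⟨$⟩ʳ_)
open import Data.Fin.Properties using (_≟_)
open import Data.Integer.Base using (+_)
open import Data.List.Base using (List; foldr; length; map; take)
open import Data.List.Relation.Unary.All using (All)
open import Data.Nat.Base using (ℕ; NonZero; _+_; _*_; _∸_; _<_; _≤_)
open import Data.Nat.DivMod using (_mod_)
open import Data.Product.Base using (∃; ∃-syntax; Σ-syntax; _×_; proj₁)
open import Data.Rational.Base as ℚ using (ℚ; 0ℚ; 1ℚ; ½; _/_)
open import Data.Rational.Properties using (+-0-commutativeMonoid)
open import Data.Sum.Base using (_⊎_)
open import Data.Vec.Functional as Vector using (Vector; []; _∷_; _++_; zipWith)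
open import Relation.Binary.Construct.Closure.Equivalence using (EqClosure)
open import Relation.Binary.Core using (Rel)
open import Relation.Binary.PropositionalEquality.Core using (_≡_; _≢_)
open import Relation.Nullary.Decidable.Core using (does)
open import Relation.Nullary.Negation.Core using (¬_)

open import Algebra.Properties.CommutativeMonoid.Sum +-0-commutativeMonoid public
  using (sum)

private
  variable
    m n p : ℕ

Matrix : ℕ → ℕ → Set
Matrix m n = Vector (Vector ℚ n) m

infix  4 _≐_
infixl 6 _⊝_
infixl 7 _·_ _·ᵛ_ _•_
infix  9 _ᵀ

_≐_ : Matrix m n → Matrix m n → Set
A ≐ B = ∀ i j → A i j ≡ B i j

O : Matrix m n
O _ _ = 0ℚ

J : Matrix m n
J _ _ = 1ℚ

I : Matrix n n
I i j = if does (i ≟ j) then 1ℚ else 0ℚ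

_ᵀ : Matrix m n → Matrix n m
_ᵀ = Vector.transpose

_⊝_ : Matrix m n → Matrix m n → Matrix m n
(A ⊝ B) i j = A i j ℚ.- B i j

_•_ : ℚ → Matrix m n → Matrix m n
(q • A) i j = q ℚ.* A i j

_·_ : Matrix m n → Matrix n p → Matrix m p
(A · B) i k = sum λ j → A i j ℚ.* B j k

_·ᵛ_ : Matrix m n → Vector ℚ n → Vector ℚ m
(A ·ᵛ v) i = sum λ j → A i j ℚ.* v j

∏ : List (Matrix n n) → Matrix n n
∏ = foldr _·_ I

-- ⟦ A , B ⨾ C , D ⟧ is the block matrix with rows of blocks A B and C D.
⟦_,_⨾_,_⟧ : Matrix m m → Matrix m n → Matrix n m → Matrix n n →
            Matrix (m + n) (m + n)
⟦ A , B ⨾ C , D ⟧ = zipWith _++_ A B ++ zipWith _++_ C D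

-- The index k - 1 of the usual circulant(X₁,…,Xₘ) is the argument of X here,
-- so block (i , j) is X ((j - i) mod m).
circulant : .{{NonZero m}} → Vector (Matrix 2 2) m → Matrix (m * 2) (m * 2)
circulant {m} X r c =
  X ((toℕ (quotient {m} 2 c) + (m ∸ toℕ (quotient {m} 2 r))) mod m)
    (remainder {m} 2 r) (remainder {m} 2 c)

permutationMatrix : Permutation′ n → Matrix n n
permutationMatrix π i j = if does (π ⟨$⟩ʳ i ≟ j) then 1ℚ else 0ℚ

Is01 : ℚ → Set
Is01 x = x ≡ 0ℚ ⊎ x ≡ 1ℚ

record IsAdjacency (A : Matrix n n) : Set where
  field
    symmetric    : A ᵀ ≐ A
    entries01    : ∀ i j → Is01 (A i j)
    zeroDiagonal : ∀ i → A i i ≡ 0ℚ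

record IsRegularOrthogonal (R : Matrix n n) : Set where
  field
    orthogonalˡ : R ᵀ · R ≐ I
    orthogonalʳ : R · R ᵀ ≐ I
    rowSums     : ∀ i → sum (R i) ≡ 1ℚ

IsIntegral : Matrix m n → Set
IsIntegral A = ∀ i j → ∃[ z ] A i j ≡ z / 1

record IsLevel (A : Matrix m n) (ℓ : ℕ) : Set where
  field
    positive : 0 < ℓ
    integral : IsIntegral ((+ ℓ / 1) • A)
    minimal  : ∀ k → 0 < k → IsIntegral ((+ k / 1) • A) → ℓ ≤ k

-- After permuting rows by σ and columns by τ the matrix is diag(X , Y) with
-- X of order k and Y of order n - k, both non-empty.
Decomposable : Matrix n n → Set
Decomposable {n} A =
  Σ[ σ ∈ Permutation′ n ] Σ[ τ ∈ Permutation′ n ] ∃[ k ] 0 < k × k < n ×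
    (∀ i j → (toℕ i < k × k ≤ toℕ j) ⊎ (k ≤ toℕ i × toℕ j < k) →
      A (σ ⟨$⟩ʳ i) (τ ⟨$⟩ʳ j) ≡ 0ℚ)

𝓥 : Matrix n n → Vector ℚ n → Set
𝓥 R v = (∀ i → Is01 (v i)) × (∀ i → Is01 ((R ᵀ ·ᵛ v) i))

𝓑 : Matrix n n → Matrix n n → Set
𝓑 R B = IsAdjacency B × IsAdjacency (R ᵀ · B · R)

record IsFactor (R : Matrix n n) : Set where
  field
    decomposable      : Decomposable R
    regularOrthogonal : IsRegularOrthogonal R
    level≤2           : ∃[ ℓ ] ℓ ≤ 2 × IsLevel R ℓ

extend : ∀ m → Matrix n n → Matrix (n + m) (n + m)
extend m R = ⟦ R , O ⨾ O , I {m} ⟧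

-- Intended for indecomposable regular orthogonal R of level 2 and B in 𝓑 R.
record Reducible (R B : Matrix n n) : Set where
  field
    factors   : List (Matrix n n)
    isFactor  : All IsFactor factors
    product   : R ≐ ∏ factors
    adjacency : ∀ i → 1 ≤ i → i < length factors →
                ∀ m (V : Matrix n m) (W : Matrix m m) →
                (∀ j → 𝓥 R ((V ᵀ) j)) →
                let A = ⟦ B , V ⨾ V ᵀ , W ⟧
                    Q = ∏ (map (extend m) (take i factors))
                in IsAdjacency A → IsAdjacency (Q ᵀ · A · Q)

Irreducible : Matrix n n → Matrix n n → Set
Irreducible R B = ¬ Reducible R B

Y : Matrix 2 2
Y = ((+ 2 / 1) • I) ⊝ J

N : Matrix 2 2
N = (0ℚ ∷ 0ℚ ∷ [])
  ∷ (1ℚ ∷ 1ℚ ∷ [])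
  ∷ []

R₁₀ : Matrix 10 10
R₁₀ = ½ • circulant (J ∷ O ∷ O ∷ O ∷ Y ∷ [])

-- Complements block (i , j) and block (j , i), where i and j are block indices.
complementBlocks : (i j : Fin m) → Matrix (m * 2) (m * 2) → Matrix (m * 2) (m * 2)
complementBlocks {m} i j B r c =
  if inBlock i j ∨ inBlock j i then 1ℚ ℚ.- B r c else B r c
  where
  inBlock : (k l : Fin m) → Bool
  inBlock k l = does (quotient {m} 2 r ≟ k) ∧ does (quotient {m} 2 c ≟ l)

data Move (B B′ : Matrix 10 10) : Set where
  complement      : B′ ≐ J ⊝ I ⊝ B → Move B B′
  blockComplement : (i j : Fin 5) → i ≢ j → B′ ≐ complementBlocks i j B → Move B B′
  conjugation     : (π π′ : Permutation′ 10) →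
                    let P  = permutationMatrix π
                        P′ = permutationMatrix π′
                    in P ᵀ · R₁₀ · P′ ≐ R₁₀ → B′ ≐ P ᵀ · B · P → Move B B′

infix 4 _∼_

_∼_ : Rel (∃ (𝓑 R₁₀)) _
_∼_ = EqClosure λ B B′ → Move (proj₁ B) (proj₁ B′)

representative : Fin 3 → Matrix 10 10
representative zero             = circulant (O ∷ O ∷ N   ∷ N ᵀ ∷ O   ∷ [])
representative (suc zero)       = circulant (O ∷ I ∷ N   ∷ N ᵀ ∷ I   ∷ [])
representative (suc (suc zero)) = circulant (O ∷ N ∷ N ᵀ ∷ N   ∷ N ᵀ ∷ [])

{-# OPTIONS --safe #-}
{-
Let 1ᵢ be the indicator of block i and δᵢ the vector (1 , -1) on block i.  The
matrix S_σ with 1ᵢ ↦ 1ᵢ and δᵢ ↦ δ_(σ i) is regular orthogonal of level at most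
2, S_σ S_τ = S_(σ τ), and R₁₀ = S_next for the 5-cycle next.  Writing 2×2 blocks
in the Hadamard basis (total, column, row and cross difference) shows that all
blocks of a B in 𝓑 R₁₀ are even, hence constant, row-, column- or twist-shaped
up to complementation, and that S_σᵀ B S_σ is an adjacency matrix exactly when
the shapes satisfy a coherence condition depending on σ.  Finitely many shape
patterns are coherent for next.  All but three are also coherent for some π
that is a transposition or a double transposition, and then R₁₀ = S_π S_(π⁻¹ next)
is a reduction into decomposable factors.

Conversely, the columns of a matrix S that maps 𝓥 R₁₀ to 01-vectors have the
form ½ (1ᵢ ± δⱼ), so every proper prefix of a factorisation is S_σ up to the
order of its columns.  For the three remaining patterns coherence forces σ = id
or σ = next; the first factor at which σ becomes next is indecomposable.
-}
module Submission where

open import Defs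
open import Algebra.Bundles using (CommutativeRing)
open import Data.Bool.Base using (Bool; true; false; T; not; _∧_; _∨_; _xor_; if_then_else_)
import Data.Bool.Properties as Bool
open import Data.Empty using (⊥)
open import Data.Fin.Base using (Fin; zero; suc; toℕ; quotient; remainder; combine; _↑ˡ_; _↑ʳ_; splitAt; join)
open import Data.Fin.Patterns
open import Data.Fin.Permutation as Perm using (Permutation′; _⟨$⟩ʳ_; _⟨$⟩ˡ_; permutation; transpose; _∘ₚ_)
open import Data.Fin.Properties as Fin using (all?; any?; _≟_)
open import Data.Integer.Base as ℤ using (ℤ; -[1+_]; _⊖_)
open import Data.List.Base as List using (List; []; _∷_; _++_)
open import Data.List.Membership.Propositional.Properties using (∈-allFin; ∈-cartesianProduct⁺)
import Data.List.Properties as List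
open import Data.List.Relation.Unary.All as All using (All; []; _∷_)
open import Data.Nat.Base as ℕ using (ℕ; zero; suc)
open import Data.Nat.DivMod using (_mod_)
import Data.Nat.Properties as ℕ
open import Data.Product.Base using (∃; ∃-syntax; Σ-syntax; _×_; _,_; proj₁; proj₂)
open import Data.Rational.Base as ℚ using (ℚ; 0ℚ; 1ℚ; ½; _+_; _*_; _-_; -_)
import Data.Rational.Properties as ℚ
open import Data.Rational.Solver using (module +-*-Solver)
open import Data.Rational.Unnormalised.Base using (mkℚᵘ; *≡*)
open import Data.Sum.Base as Sum using (_⊎_; inj₁; inj₂; [_,_]′)
open import Data.Unit.Base using (tt)
open import Data.Vec.Functional as Vector using (Vector)
open import Function.Base using (_∘_; id)
open import Function.Bundles using (module Equivalence)
open import Relation.Binary.Construct.Closure.ReflexiveTransitive using (ε; _◅_; _◅◅_)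
open import Relation.Binary.Construct.Closure.Symmetric using (fwd; bwd)
open import Relation.Binary.Definitions using (DecidableEquality)
open import Relation.Binary.PropositionalEquality hiding (J)
open import Relation.Nullary.Decidable
  using (Dec; yes; no; does; map′; toWitness; decidable-stable; ¬?; _×-dec_; _⊎-dec_; _→-dec_)
open import Relation.Nullary.Negation using (¬_; contradiction)
open import Relation.Unary using (Decidable)

open import Algebra.Properties.CommutativeMonoid.Sum ℚ.+-0-commutativeMonoid
  using (sum-cong-≗; sum-replicate-zero; ∑-comm; ∑-distrib-+)
open import Algebra.Properties.Semiring.Sum
  (CommutativeRing.semiring ℚ.+-*-commutativeRing)
  using (*-distribˡ-sum; *-distribʳ-sum)
open ≡-Reasoning
open +-*-Solver using (solve; _:=_; _:+_; _:*_; _:-_; con)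

-- The factors of an arbitrary factorisation need not have the form S_σ. Only products of proper
-- prefixes are constrained, so the irreducibility argument follows these products and never
-- classifies single factors. The constraint works through the border: membership in 𝓥 R₁₀ means
-- that all five block sums have the same parity, a condition that does not mention `next`. Hence
-- every S_σ respects every admissible border, which makes borders harmless when a reduction is
-- built; yet there are enough such vectors to determine the columns of a prefix.
--
-- That `next` is a single 5-cycle matters in three ways. Parity travels along it, so evenness of
-- the diagonal blocks spreads to all blocks. Its columns chain all blocks together, which excludes
-- a block-diagonal form. And multiplying it by a transposition splits it into two orbits, so both
-- factors of the reduction preserve a proper set of blocks; the double transpositions used here
-- also leave an intransitive cofactor.
--
-- Each exceptional pattern occurs with all diagonal blocks flat or all of them twisted.
-- Complementation exchanges the two versions, which is why three classes remain.

private
  variable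
    m n p : ℕ

-- Shapes of blocks and the classification of coherent patterns

-- Up to complementation, a 2×2 block with an even number of ones has one of
-- four shapes: its (a , b) entry is 0, a, b or a + b modulo 2.
data Shape : Set where
  flat row col twist : Shape

swap : Shape → Shape
swap flat  = flat
swap row   = col
swap col   = row
swap twist = twist

isFlat isRow isCol isTwist : Shape → Bool
isFlat flat  = true
isFlat _     = false
isRow row = true
isRow _ = false
isCol col = true
isCol _ = false
isTwist twist = true
isTwist _ = false

index : Shape → Fin 4
index flat  = 0F
index row   = 1F
index col   = 2F
index twist = 3F

shape : Fin 4 → Shape
shape 0F = flat
shape 1F = row
shape 2F = col
shape 3F = twist

shape-index : ∀ s → shape (index s) ≡ s
shape-index flat  = refl
shape-index row   = refl
shape-index col   = refl
shape-index twist = refl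

infix 4 _≟ˢ_
_≟ˢ_ : DecidableEquality Shape
s ≟ˢ t = map′ (λ eq → trans (sym (shape-index s)) (trans (cong shape eq) (shape-index t)))
              (cong index) (index s Fin.≟ index t)

all-Shape? : ∀ {p} {P : Shape → Set p} → Decidable P → Dec (∀ s → P s)
all-Shape? P? = map′ (λ { (f , r , c , t) → λ { flat → f ; row → r ; col → c ; twist → t } })
                     (λ p → p flat , p row , p col , p twist)
                     (P? flat ×-dec P? row ×-dec P? col ×-dec P? twist)

Pattern : Set
Pattern = Fin 5 → Fin 5 → Shape

weight : Bool → ℕ
weight b = if b then 1 else 0

count : Bool → Bool → Bool → Bool → ℕ
count a b c d = weight a ℕ.+ weight b ℕ.+ weight c ℕ.+ weight d

-- If block (i , j) of Sᵀ·B·S, where S = matrix σ, is an even 01-block, then it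
-- takes its total from block (i , j) of B, its column difference from
-- (i , σ j), its row difference from (σ i , j) and its cross difference from
-- (σ i , σ j).  Its own shape makes exactly one of these the distinguished one.
Compatible : Shape → Shape → Shape → Shape → Set
Compatible s t u v = count (isFlat s) (isCol t) (isRow u) (isTwist v) ≡ 1

compatible? : ∀ s t u v → Dec (Compatible s t u v)
compatible? s t u v = count (isFlat s) (isCol t) (isRow u) (isTwist v) ℕ.≟ 1

Coherent : Pattern → (Fin 5 → Fin 5) → Set
Coherent A σ = ∀ i j → Compatible (A i j) (A i (σ j)) (A (σ i) j) (A (σ i) (σ j))

coherent? : ∀ A σ → Dec (Coherent A σ)
coherent? A σ = all? λ i → all? λ j → compatible? (A i j) (A i (σ j)) (A (σ i) j) (A (σ i) (σ j))

next prev : Fin 5 → Fin 5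
next 0F = 1F
next 1F = 2F
next 2F = 3F
next 3F = 4F
next 4F = 0F
prev 0F = 4F
prev 1F = 0F
prev 2F = 1F
prev 3F = 2F
prev 4F = 3F

tuple : {X : Set} → X → X → X → X → X → Vector X 5
tuple x₀ x₁ x₂ x₃ x₄ = x₀ Vector.∷ x₁ Vector.∷ x₂ Vector.∷ x₃ Vector.∷ x₄ Vector.∷ Vector.[]

rotation : Permutation′ 5
rotation = permutation next prev
  (λ { 0F → refl ; 1F → refl ; 2F → refl ; 3F → refl ; 4F → refl })
  (λ { 0F → refl ; 1F → refl ; 2F → refl ; 3F → refl ; 4F → refl })

-- d is the shape of the diagonal blocks, a i that of block (i , i + 1) and b i
-- that of block (i , i + 2).
cyclic : Shape → Vector Shape 5 → Vector Shape 5 → Pattern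
cyclic d a b i j = entry ((toℕ j ℕ.+ (5 ℕ.∸ toℕ i)) mod 5)
  where
  entry : Fin 5 → Shape
  entry 0F = d
  entry 1F = a i
  entry 2F = b i
  entry 3F = swap (b j)
  entry 4F = swap (a j)

-- Every pattern that is coherent for next, except the three irreducible ones,
-- is also coherent for one of these permutations.
middle : Fin 4 → Fin 5 → Permutation′ 5
middle 0F i = transpose (next i) (next (next i))
middle 1F i = transpose (next i) (prev (prev i))
middle 2F i = transpose (next i) (next (next i)) ∘ₚ transpose (prev (prev i)) (prev i)
middle 3F i = transpose (next i) (prev i) ∘ₚ transpose (next (next i)) (prev (prev i))

irreducibleShape : Fin 3 → Shape → Pattern
irreducibleShape 0F d = cyclic d (λ _ → flat)  (λ _ → row)
irreducibleShape 1F d = cyclic d (λ _ → twist) (λ _ → row)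
irreducibleShape 2F d = cyclic d (λ _ → row)   (λ _ → col)

Outcome : Shape → Vector Shape 5 → Vector Shape 5 → Set
Outcome d a b =
  (∃[ k ] ∀ i j → cyclic d a b i j ≡ irreducibleShape k d i j) ⊎
  (∃[ m ] ∃[ i ] Coherent (cyclic d a b) (middle m i ⟨$⟩ʳ_))

outcome? : ∀ d a b → Dec (Outcome d a b)
outcome? d a b =
  any? (λ k → all? λ i → all? λ j → cyclic d a b i j ≟ˢ irreducibleShape k d i j) ⊎-dec
  any? (λ m → any? λ i → coherent? (cyclic d a b) (middle m i ⟨$⟩ʳ_))

-- The order of the quantifiers lets each constraint prune the search as soon
-- as the shapes it mentions are fixed.
Classified : Shape → Set
Classified d =
  ∀ a₀ → a₀ ≢ col → ∀ a₁ → a₁ ≢ col → ∀ b₀ → Compatible a₀ b₀ d a₁ →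
  ∀ a₂ → a₂ ≢ col → ∀ b₁ → Compatible a₁ b₁ d a₂ →
  ∀ a₃ → a₃ ≢ col → ∀ b₂ → Compatible a₂ b₂ d a₃ →
  ∀ a₄ → a₄ ≢ col → ∀ b₃ → Compatible a₃ b₃ d a₄ →
  Compatible b₀ (swap b₃) a₁ b₁ → Compatible b₂ (swap b₀) a₃ b₃ →
  ∀ b₄ → Compatible a₄ b₄ d a₀ →
  Compatible b₁ (swap b₄) a₂ b₂ → Compatible b₃ (swap b₁) a₄ b₄ → Compatible b₄ (swap b₂) a₀ b₀ →
  Outcome d (tuple a₀ a₁ a₂ a₃ a₄) (tuple b₀ b₁ b₂ b₃ b₄)

classify? : ∀ d → Dec (Classified d)
classify? d =
  all-Shape? λ a₀ → ¬? (a₀ ≟ˢ col) →-dec all-Shape? λ a₁ → ¬? (a₁ ≟ˢ col) →-dec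
  all-Shape? λ b₀ → compatible? a₀ b₀ d a₁ →-dec
  all-Shape? λ a₂ → ¬? (a₂ ≟ˢ col) →-dec all-Shape? λ b₁ → compatible? a₁ b₁ d a₂ →-dec
  all-Shape? λ a₃ → ¬? (a₃ ≟ˢ col) →-dec all-Shape? λ b₂ → compatible? a₂ b₂ d a₃ →-dec
  all-Shape? λ a₄ → ¬? (a₄ ≟ˢ col) →-dec all-Shape? λ b₃ → compatible? a₃ b₃ d a₄ →-dec
  compatible? b₀ (swap b₃) a₁ b₁ →-dec compatible? b₂ (swap b₀) a₃ b₃ →-dec
  all-Shape? λ b₄ → compatible? a₄ b₄ d a₀ →-dec
  compatible? b₁ (swap b₄) a₂ b₂ →-dec compatible? b₃ (swap b₁) a₄ b₄ →-dec
  compatible? b₄ (swap b₂) a₀ b₀ →-dec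
  outcome? d (tuple a₀ a₁ a₂ a₃ a₄) (tuple b₀ b₁ b₂ b₃ b₄)

classified-flat : Classified flat
classified-flat = toWitness {a? = classify? flat} _

classified-twist : Classified twist
classified-twist = toWitness {a? = classify? twist} _

-- Matrices over ℚ

sum-zero : {f : Vector ℚ n} → (∀ i → f i ≡ 0ℚ) → sum f ≡ 0ℚ
sum-zero {n} f≗0 = trans (sum-cong-≗ f≗0) (sum-replicate-zero n)

I-diag : (i : Fin n) → I i i ≡ 1ℚ
I-diag i with i ≟ i
... | yes _ = refl
... | no i≢i = contradiction refl i≢i

I-off : {i j : Fin n} → i ≢ j → I i j ≡ 0ℚ
I-off {i = i} {j} i≢j with i ≟ j
... | yes i≡j = contradiction i≡j i≢j
... | no _ = refl

I-sym : (i j : Fin n) → I i j ≡ I j i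
I-sym i j with i ≟ j
... | yes refl = sym (I-diag i)
... | no i≢j  = sym (I-off (i≢j ∘ sym))

I-suc : (i j : Fin n) → I (suc i) (suc j) ≡ I i j
I-suc i j with i ≟ j
... | yes _ = refl
... | no  _ = refl

sum-select : (i : Fin n) (f : Vector ℚ n) → sum (λ j → I i j * f j) ≡ f i
sum-select zero f = begin
  1ℚ * f zero + sum (λ j → 0ℚ * f (suc j)) ≡⟨ cong₂ _+_ (ℚ.*-identityˡ (f zero))
      (sum-zero λ j → ℚ.*-zeroˡ (f (suc j))) ⟩
  f zero + 0ℚ                              ≡⟨ ℚ.+-identityʳ (f zero) ⟩
  f zero ∎
sum-select (suc i) f = begin
  0ℚ * f zero + sum (λ j → I (suc i) (suc j) * f (suc j)) ≡⟨ cong₂ _+_ (ℚ.*-zeroˡ (f zero))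
      (sum-cong-≗ λ j → cong (_* f (suc j)) (I-suc i j)) ⟩
  0ℚ + sum (λ j → I i j * f (suc j))                      ≡⟨ ℚ.+-identityˡ _ ⟩
  sum (λ j → I i j * f (suc j))                           ≡⟨ sum-select i (f ∘ suc) ⟩
  f (suc i) ∎

sum-split : ∀ m {n} (f : Vector ℚ (m ℕ.+ n)) → sum f ≡ sum (λ i → f (i ↑ˡ n)) + sum (λ i → f (m ↑ʳ i))
sum-split zero f = sym (ℚ.+-identityˡ _)
sum-split (suc m) {n} f = trans (cong (f zero +_) (sum-split m (f ∘ suc)))
    (sym (ℚ.+-assoc (f zero) (sum λ i → f (suc (i ↑ˡ n))) (sum λ i → f (suc (m ↑ʳ i)))))

sum-combine : ∀ {m} (f : Vector ℚ (m ℕ.* 2)) → sum f ≡ sum {m}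
    (λ i → f (combine i 0F) + f (combine i 1F))
sum-combine {zero} f = refl
sum-combine {suc m} f = begin
  f 0F + (f 1F + sum g)   ≡⟨ ℚ.+-assoc (f 0F) (f 1F) (sum g) ⟨
  f 0F + f 1F + sum g     ≡⟨ cong (f 0F + f 1F +_) (sum-combine {m} g) ⟩
  f 0F + f 1F + sum {m} (λ i → g (combine i 0F) + g (combine i 1F)) ∎
  where g = λ i → f (suc (suc i))

≐-refl : {A : Matrix m n} → A ≐ A
≐-refl _ _ = refl

≐-sym : {A B : Matrix m n} → A ≐ B → B ≐ A
≐-sym A≐B i j = sym (A≐B i j)

≐-trans : {A B C : Matrix m n} → A ≐ B → B ≐ C → A ≐ C
≐-trans A≐B B≐C i j = trans (A≐B i j) (B≐C i j)

·-cong : {A A′ : Matrix m n} {B B′ : Matrix n p} → A ≐ A′ → B ≐ B′ → A · B ≐ A′ · B′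
·-cong A≐A′ B≐B′ i k = sum-cong-≗ λ j → cong₂ _*_ (A≐A′ i j) (B≐B′ j k)

·-assoc : ∀ {m n p q} (A : Matrix m n) (B : Matrix n p) (C : Matrix p q) → A · B · C ≐ A · (B · C)
·-assoc A B C i l = begin
  sum (λ k → sum (λ j → A i j * B j k) * C k l)   ≡⟨ sum-cong-≗
      (λ k → *-distribʳ-sum (C k l) (λ j → A i j * B j k)) ⟩
  sum (λ k → sum (λ j → A i j * B j k * C k l))   ≡⟨ ∑-comm (λ k j → A i j * B j k * C k l) ⟩
  sum (λ j → sum (λ k → A i j * B j k * C k l))   ≡⟨ sum-cong-≗
      (λ j → trans (sum-cong-≗ λ k → ℚ.*-assoc (A i j) (B j k) (C k l))
          (sym (*-distribˡ-sum (A i j) (λ k → B j k * C k l)))) ⟩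
  sum (λ j → A i j * sum (λ k → B j k * C k l))   ∎

·-identityˡ : (A : Matrix m n) → I · A ≐ A
·-identityˡ A i k = sum-select i (λ j → A j k)

·-identityʳ : (A : Matrix m n) → A · I ≐ A
·-identityʳ A i k = trans (sum-cong-≗ λ j → trans (ℚ.*-comm (A i j) (I j k))
    (cong (_* A i j) (I-sym j k))) (sum-select k (A i))

ᵀ-· : (A : Matrix m n) (B : Matrix n p) → (A · B) ᵀ ≐ B ᵀ · A ᵀ
ᵀ-· A B k i = sum-cong-≗ λ j → ℚ.*-comm (A i j) (B j k)

congruence-cong : {S S′ B B′ : Matrix n n} → S ≐ S′ → B ≐ B′ → S ᵀ · B · S ≐ S′ ᵀ · B′ · S′
congruence-cong S≐S′ B≐B′ = ·-cong (·-cong (λ i j → S≐S′ j i) B≐B′) S≐S′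

congruence-symmetric : (S B : Matrix n n) → B ᵀ ≐ B → (S ᵀ · B · S) ᵀ ≐ S ᵀ · B · S
congruence-symmetric S B Bᵀ≐B =
  ≐-trans (ᵀ-· (S ᵀ · B) S)
  (≐-trans (·-cong (≐-refl {A = S ᵀ}) (≐-trans (ᵀ-· (S ᵀ) B) (·-cong Bᵀ≐B (≐-refl {A = S}))))
  (≐-sym (·-assoc (S ᵀ) B S)))

isAdjacency-resp : {A B : Matrix n n} → A ≐ B → IsAdjacency A → IsAdjacency B
isAdjacency-resp A≐B adj = record
  { symmetric    = λ i j → trans (sym (A≐B j i)) (trans (symmetric i j) (A≐B i j))
  ; entries01    = λ i j → subst Is01 (A≐B i j) (entries01 i j)
  ; zeroDiagonal = λ i → trans (sym (A≐B i i)) (zeroDiagonal i)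
  }
  where open IsAdjacency adj

-- Block matrices and congruence of bordered matrices

private
  lookup-++ˡ : ∀ {A : Set} (xs : Vector A m) (ys : Vector A n) i → (xs Vector.++ ys) (i ↑ˡ n) ≡ xs i
  lookup-++ˡ {m = m} {n} xs ys i = cong [ xs , ys ]′ (Fin.splitAt-↑ˡ m i n)

  lookup-++ʳ : ∀ {A : Set} (xs : Vector A m) (ys : Vector A n) i → (xs Vector.++ ys) (m ↑ʳ i) ≡ ys i
  lookup-++ʳ {m = m} {n} xs ys i = cong [ xs , ys ]′ (Fin.splitAt-↑ʳ m n i)

module _ (A : Matrix m m) (B : Matrix m n) (C : Matrix n m) (D : Matrix n n) where

  block₁₁ : ∀ i j → ⟦ A , B ⨾ C , D ⟧ (i ↑ˡ n) (j ↑ˡ n) ≡ A i j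
  block₁₁ i j = trans (cong-app (lookup-++ˡ _ (Vector.zipWith Vector._++_ C D) i) _)
      (lookup-++ˡ (A i) (B i) j)

  block₁₂ : ∀ i j → ⟦ A , B ⨾ C , D ⟧ (i ↑ˡ n) (m ↑ʳ j) ≡ B i j
  block₁₂ i j = trans (cong-app (lookup-++ˡ _ (Vector.zipWith Vector._++_ C D) i) _)
      (lookup-++ʳ (A i) (B i) j)

  block₂₁ : ∀ i j → ⟦ A , B ⨾ C , D ⟧ (m ↑ʳ i) (j ↑ˡ n) ≡ C i j
  block₂₁ i j = trans (cong-app (lookup-++ʳ (Vector.zipWith Vector._++_ A B) _ i) _)
      (lookup-++ˡ (C i) (D i) j)

  block₂₂ : ∀ i j → ⟦ A , B ⨾ C , D ⟧ (m ↑ʳ i) (m ↑ʳ j) ≡ D i j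
  block₂₂ i j = trans (cong-app (lookup-++ʳ (Vector.zipWith Vector._++_ A B) _ i) _)
      (lookup-++ʳ (C i) (D i) j)

data View (m n : ℕ) : Fin (m ℕ.+ n) → Set where
  left  : (i : Fin m) → View m n (i ↑ˡ n)
  right : (i : Fin n) → View m n (m ↑ʳ i)

view : ∀ m {n} (i : Fin (m ℕ.+ n)) → View m n i
view m {n} i = subst (View m n) (Fin.join-splitAt m n i) (go (splitAt m i))
  where
  go : (s : Fin m ⊎ Fin n) → View m n (join m n s)
  go (inj₁ i) = left i
  go (inj₂ i) = right i

module _ (S : Matrix n n) (m : ℕ) (f : Vector ℚ (n ℕ.+ m)) where

  sum-extendˡ : ∀ c → sum (λ r → f r * extend m S r (c ↑ˡ m)) ≡ sum (λ r → f (r ↑ˡ m) * S r c)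
  sum-extendˡ c = begin
    sum (λ r → f r * extend m S r (c ↑ˡ m)) ≡⟨ sum-split n _ ⟩
    sum (λ r → f (r ↑ˡ m) * extend m S (r ↑ˡ m) (c ↑ˡ m)) + sum
        (λ r → f (n ↑ʳ r) * extend m S (n ↑ʳ r) (c ↑ˡ m))
      ≡⟨ cong₂ _+_ (sum-cong-≗ λ r → cong (f (r ↑ˡ m) *_) (block₁₁ S O O I r c))
                   (sum-zero λ r → trans (cong (f (n ↑ʳ r) *_) (block₂₁ S O O I r c))
                       (ℚ.*-zeroʳ (f (n ↑ʳ r)))) ⟩
    sum (λ r → f (r ↑ˡ m) * S r c) + 0ℚ ≡⟨ ℚ.+-identityʳ _ ⟩
    sum (λ r → f (r ↑ˡ m) * S r c) ∎

  sum-extendʳ : ∀ c → sum (λ r → f r * extend m S r (n ↑ʳ c)) ≡ f (n ↑ʳ c)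
  sum-extendʳ c = begin
    sum (λ r → f r * extend m S r (n ↑ʳ c)) ≡⟨ sum-split n _ ⟩
    sum (λ r → f (r ↑ˡ m) * extend m S (r ↑ˡ m) (n ↑ʳ c)) + sum
        (λ r → f (n ↑ʳ r) * extend m S (n ↑ʳ r) (n ↑ʳ c))
      ≡⟨ cong₂ _+_ (sum-zero λ r → trans (cong (f (r ↑ˡ m) *_) (block₁₂ S O O I r c))
          (ℚ.*-zeroʳ (f (r ↑ˡ m))))
                   (sum-cong-≗ λ r → cong (f (n ↑ʳ r) *_) (block₂₂ S O O I r c)) ⟩
    0ℚ + sum (λ r → f (n ↑ʳ r) * I r c) ≡⟨ ℚ.+-identityˡ _ ⟩
    sum (λ r → f (n ↑ʳ r) * I r c) ≡⟨ ·-identityʳ (λ (_ : Fin 1) r → f (n ↑ʳ r)) 0F c ⟩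
    f (n ↑ʳ c) ∎

extend-I : ∀ m → extend {n} m I ≐ I
extend-I {n} m i j with view n i | view n j
... | left i  | left j  = trans (block₁₁ I O O I i j) (embed i j)
  where
  embed : ∀ {n} (i j : Fin n) → I i j ≡ I (i ↑ˡ m) (j ↑ˡ m)
  embed i j with i ≟ j
  ... | yes refl = sym (I-diag (i ↑ˡ m))
  ... | no i≢j = sym (I-off (i≢j ∘ Fin.↑ˡ-injective m i j))
... | left i  | right j = trans (block₁₂ {m = n} I O O I i j) (sym (I-off (apart i j)))
  where
  apart : ∀ {n} (i : Fin n) (j : Fin m) → i ↑ˡ m ≢ n ↑ʳ j
  apart {n} i j eq with trans (sym (Fin.splitAt-↑ˡ n i m))
      (trans (cong (splitAt n) eq) (Fin.splitAt-↑ʳ n m j))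
  ... | ()
... | right i | left j  = trans (block₂₁ {m = n} I O O I i j) (sym (I-off (apart i j)))
  where
  apart : ∀ {n} (i : Fin m) (j : Fin n) → n ↑ʳ i ≢ j ↑ˡ m
  apart {n} i j eq with trans (sym (Fin.splitAt-↑ˡ n j m))
      (trans (cong (splitAt n) (sym eq)) (Fin.splitAt-↑ʳ n m i))
  ... | ()
... | right i | right j = trans (block₂₂ {m = n} I O O I i j) (embed i j)
  where
  embed : (i j : Fin m) → I i j ≡ I (n ↑ʳ i) (n ↑ʳ j)
  embed i j with i ≟ j
  ... | yes refl = sym (I-diag (n ↑ʳ i))
  ... | no i≢j = sym (I-off (i≢j ∘ Fin.↑ʳ-injective n i j))

extend-· : ∀ m (A B : Matrix n n) → extend m A · extend m B ≐ extend m (A · B)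
extend-· {n} m A B i j with view n i | view n j
... | left i  | left j  = trans (sum-extendˡ B m (extend m A (i ↑ˡ m)) j)
  (trans (sum-cong-≗ λ k → cong (_* B k j) (block₁₁ A O O I i k)) (sym (block₁₁ (A · B) O O I i j)))
... | left i  | right j = trans (sum-extendʳ B m (extend m A (i ↑ˡ m)) j)
  (trans (block₁₂ A O O I i j) (sym (block₁₂ (A · B) O O I i j)))
... | right i | left j  = trans (sum-extendˡ B m (extend m A (n ↑ʳ i)) j)
  (trans (sum-zero λ k → trans (cong (_* B k j) (block₂₁ A O O I i k)) (ℚ.*-zeroˡ (B k j)))
      (sym (block₂₁ (A · B) O O I i j)))
... | right i | right j = trans (sum-extendʳ B m (extend m A (n ↑ʳ i)) j)
  (trans (block₂₂ A O O I i j) (sym (block₂₂ (A · B) O O I i j)))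

-- `Reducible` multiplies the enlarged factors. Taking the border out of the product allows a prefix
-- to be treated as one matrix of the order of R.
∏-extend : ∀ m (Rs : List (Matrix n n)) → ∏ (List.map (extend m) Rs) ≐ extend m (∏ Rs)
∏-extend m []       = ≐-sym (extend-I m)
∏-extend m (R ∷ Rs) = ≐-trans (·-cong (≐-refl {A = extend m R}) (∏-extend m Rs)) (extend-· m R (∏ Rs))

module _ (S : Matrix n n) (B : Matrix n n) {m} (V : Matrix n m) (W : Matrix m m) where
  private
    A = ⟦ B , V ⨾ V ᵀ , W ⟧
    Q = extend m S

    left-product : ∀ c k → (Q ᵀ · A) (c ↑ˡ m) k ≡ sum (λ r → A (r ↑ˡ m) k * S r c)
    left-product c k = trans (sum-cong-≗ λ r → ℚ.*-comm (Q r (c ↑ˡ m)) (A r k))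
        (sum-extendˡ S m (λ r → A r k) c)

    right-product : ∀ c k → (Q ᵀ · A) (n ↑ʳ c) k ≡ A (n ↑ʳ c) k
    right-product c k = trans (sum-cong-≗ λ r → ℚ.*-comm (Q r (n ↑ʳ c)) (A r k))
        (sum-extendʳ S m (λ r → A r k) c)

  -- The four formulas say that congruence by Q turns B, V, W into SᵀBS, SᵀV, W. The condition on a
  -- bordered matrix thus separates into one on B and one on each column of V.
  bordered₁₁ : ∀ i j → (Q ᵀ · A · Q) (i ↑ˡ m) (j ↑ˡ m) ≡ (S ᵀ · B · S) i j
  bordered₁₁ i j = trans (sum-extendˡ S m ((Q ᵀ · A) (i ↑ˡ m)) j)
    (sum-cong-≗ λ k → cong (_* S k j) (trans (left-product i (k ↑ˡ m))
      (sum-cong-≗ λ r → trans (cong (_* S r i) (block₁₁ B V (V ᵀ) W r k)) (ℚ.*-comm (B r k) (S r i)))))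

  bordered₁₂ : ∀ i j → (Q ᵀ · A · Q) (i ↑ˡ m) (n ↑ʳ j) ≡ (S ᵀ ·ᵛ (V ᵀ) j) i
  bordered₁₂ i j = trans (sum-extendʳ S m ((Q ᵀ · A) (i ↑ˡ m)) j)
    (trans (left-product i (n ↑ʳ j))
      (sum-cong-≗ λ r → trans (cong (_* S r i) (block₁₂ B V (V ᵀ) W r j)) (ℚ.*-comm (V r j) (S r i))))

  bordered₂₁ : ∀ i j → (Q ᵀ · A · Q) (n ↑ʳ i) (j ↑ˡ m) ≡ (S ᵀ ·ᵛ (V ᵀ) i) j
  bordered₂₁ i j = trans (sum-extendˡ S m ((Q ᵀ · A) (n ↑ʳ i)) j)
    (sum-cong-≗ λ k → trans (cong (_* S k j) (trans (right-product i (k ↑ˡ m))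
        (block₂₁ B V (V ᵀ) W i k))) (ℚ.*-comm (V k i) (S k j)))

  bordered₂₂ : ∀ i j → (Q ᵀ · A · Q) (n ↑ʳ i) (n ↑ʳ j) ≡ W i j
  bordered₂₂ i j = trans (sum-extendʳ S m ((Q ᵀ · A) (n ↑ʳ i)) j)
    (trans (right-product i (n ↑ʳ j)) (block₂₂ B V (V ᵀ) W i j))

  bordered-adjacency : IsAdjacency (S ᵀ · B · S) → (∀ i j → Is01 ((S ᵀ ·ᵛ (V ᵀ) j) i)) →
                       IsAdjacency A → IsAdjacency (Q ᵀ · A · Q)
  bordered-adjacency top side adj = record
    { symmetric    = congruence-symmetric Q A (IsAdjacency.symmetric adj)
    ; entries01    = entries
    ; zeroDiagonal = diagonal
    }
    where
    entries : ∀ i j → Is01 ((Q ᵀ · A · Q) i j)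
    entries i j with view n i | view n j
    ... | left i  | left j  = subst Is01 (sym (bordered₁₁ i j)) (IsAdjacency.entries01 top i j)
    ... | left i  | right j = subst Is01 (sym (bordered₁₂ i j)) (side i j)
    ... | right i | left j  = subst Is01 (sym (bordered₂₁ i j)) (side j i)
    ... | right i | right j = subst Is01 (trans (block₂₂ B V (V ᵀ) W i j) (sym (bordered₂₂ i j)))
                                         (IsAdjacency.entries01 adj (n ↑ʳ i) (n ↑ʳ j))

    diagonal : ∀ i → (Q ᵀ · A · Q) i i ≡ 0ℚ
    diagonal i with view n i
    ... | left i  = trans (bordered₁₁ i i) (IsAdjacency.zeroDiagonal top i)
    ... | right i = trans (bordered₂₂ i i) (trans (sym (block₂₂ B V (V ᵀ) W i i))
        (IsAdjacency.zeroDiagonal adj (n ↑ʳ i)))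

-- The matrices of block permutations

block : Fin 10 → Fin 5
block = quotient {5} 2

side : Fin 10 → Fin 2
side = remainder {5} 2

sgn : Fin 2 → ℚ
sgn 0F = 1ℚ
sgn 1F = - 1ℚ

-- ½ (1ᵢ ± δⱼ), where 1ᵢ is the indicator of block i and δⱼ is (1 , -1) on
-- block j.
column : Fin 5 → Fin 5 → Fin 2 → Vector ℚ 10
column i j b r = ½ * (I (block r) i + sgn b * (I (block r) j * sgn (side r)))

-- The linear map with 1ⱼ ↦ 1ⱼ and δⱼ ↦ δ_(σ j).  Hence σ ↦ matrix σ is
-- multiplicative, and R₁₀ is the case of the 5-cycle next.
matrix : (Fin 5 → Fin 5) → Matrix 10 10
matrix σ r c = column (block c) (σ (block c)) (side c) r

cell : Fin 5 → Fin 2 → Fin 10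
cell = combine

block-cell : ∀ i b → block (cell i b) ≡ i
block-cell i b = cong proj₁ (Fin.remQuot-combine i b)

side-cell : ∀ i b → side (cell i b) ≡ b
side-cell i b = cong proj₂ (Fin.remQuot-combine i b)

cell-block-side : ∀ r → cell (block r) (side r) ≡ r
cell-block-side = Fin.combine-remQuot {5} 2

column-cell : ∀ i j b k s → column i j b (cell k s) ≡ ½ * (I k i + sgn b * (I k j * sgn s))
column-cell i j b k s =
  cong₂ (λ l t → ½ * (I l i + sgn b * (I l j * sgn t))) (block-cell k s) (side-cell k s)

matrix-cell : ∀ σ r j b → matrix σ r (cell j b) ≡ column j (σ j) b r
matrix-cell σ r j b = cong₂ (λ l t → column l (σ l) t r) (block-cell j b) (side-cell j b)

matrix-cong : ∀ {σ τ} → (∀ i → σ i ≡ τ i) → matrix σ ≐ matrix τ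
matrix-cong σ≗τ r c = cong (λ j → column (block c) j (side c) r) (σ≗τ (block c))

equalMatrices? : (A B : Matrix 10 10) → Dec (A ≐ B)
equalMatrices? A B = all? λ i → all? λ j → A i j ℚ.≟ B i j

R₁₀≐matrix : R₁₀ ≐ matrix next
R₁₀≐matrix = toWitness {a? = equalMatrices? R₁₀ (matrix next)} tt

matrix-id : matrix id ≐ I
matrix-id = toWitness {a? = equalMatrices? (matrix id) I} tt

infix 8 _⁺_ _⁻_
-- Inner products with 1ᵢ and δᵢ, the coordinates in which all products with the columns ½ (1ᵢ ± δⱼ)
-- are computed.
_⁺_ _⁻_ : Vector ℚ 10 → Fin 5 → ℚ
f ⁺ i = f (cell i 0F) + f (cell i 1F)
f ⁻ i = f (cell i 0F) - f (cell i 1F)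

column-⁺ : ∀ i j b k → column i j b ⁺ k ≡ I k i
column-⁺ i j b k = trans (cong₂ _+_ (column-cell i j b k 0F) (column-cell i j b k 1F))
  (solve 3 (λ x s y → con ½ :* (x :+ s :* (y :* con 1ℚ)) :+ con ½ :* (x :+ s :* (y :* con (- 1ℚ))) := x)
      refl
    (I k i) (sgn b) (I k j))

column-⁻ : ∀ i j b k → column i j b ⁻ k ≡ sgn b * I k j
column-⁻ i j b k = trans (cong₂ _-_ (column-cell i j b k 0F) (column-cell i j b k 1F))
  (solve 3 (λ x s y → con ½ :* (x :+ s :* (y :* con 1ℚ)) :- con ½ :*
      (x :+ s :* (y :* con (- 1ℚ))) := s :* y) refl
    (I k i) (sgn b) (I k j))

column-dot : ∀ i j b (f : Vector ℚ 10) →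
             sum (λ r → column i j b r * f r) ≡ ½ * (f ⁺ i + sgn b * f ⁻ j)
column-dot i j b f = begin
  sum (λ r → column i j b r * f r)
    ≡⟨ sum-combine {5} (λ r → column i j b r * f r) ⟩
  sum {5} (λ k → column i j b (cell k 0F) * f (cell k 0F) + column i j b (cell k 1F) * f (cell k 1F))
    ≡⟨ sum-cong-≗ step ⟩
  sum {5} (λ k → I i k * (½ * f ⁺ k) + I j k * (½ * (sgn b * f ⁻ k)))
    ≡⟨ ∑-distrib-+ (λ k → I i k * (½ * f ⁺ k)) (λ k → I j k * (½ * (sgn b * f ⁻ k))) ⟩
  sum {5} (λ k → I i k * (½ * f ⁺ k)) + sum {5} (λ k → I j k * (½ * (sgn b * f ⁻ k)))
    ≡⟨ cong₂ _+_ (sum-select i (λ k → ½ * f ⁺ k)) (sum-select j (λ k → ½ * (sgn b * f ⁻ k))) ⟩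
  ½ * f ⁺ i + ½ * (sgn b * f ⁻ j)
    ≡⟨ ℚ.*-distribˡ-+ ½ (f ⁺ i) (sgn b * f ⁻ j) ⟨
  ½ * (f ⁺ i + sgn b * f ⁻ j) ∎
  where
  step : ∀ k → column i j b (cell k 0F) * f (cell k 0F) + column i j b (cell k 1F) * f (cell k 1F)
             ≡ I i k * (½ * f ⁺ k) + I j k * (½ * (sgn b * f ⁻ k))
  step k = trans
    (cong₂ _+_ (cong (_* f (cell k 0F)) (trans (column-cell i j b k 0F) (flipped 0F)))
               (cong (_* f (cell k 1F)) (trans (column-cell i j b k 1F) (flipped 1F))))
    (solve 5 (λ x s y u v → con ½ :* (x :+ s :* (y :* con 1ℚ)) :* u :+ con ½ :*
        (x :+ s :* (y :* con (- 1ℚ))) :* v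
                        := x :* (con ½ :* (u :+ v)) :+ y :* (con ½ :* (s :* (u :- v)))) refl
      (I i k) (sgn b) (I j k) (f (cell k 0F)) (f (cell k 1F)))
    where
    flipped : ∀ s → ½ * (I k i + sgn b * (I k j * sgn s)) ≡ ½ * (I i k + sgn b * (I j k * sgn s))
    flipped s = cong₂ (λ x y → ½ * (x + sgn b * (y * sgn s))) (I-sym k i) (I-sym k j)

dot-column : ∀ i j b (f : Vector ℚ 10) →
             sum (λ r → f r * column i j b r) ≡ ½ * (f ⁺ i + sgn b * f ⁻ j)
dot-column i j b f = trans (sum-cong-≗ λ r → ℚ.*-comm (f r) (column i j b r)) (column-dot i j b f)

matrix-· : ∀ σ τ → matrix σ · matrix τ ≐ matrix (σ ∘ τ)
matrix-· σ τ r c = begin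
  sum (λ k → matrix σ r k * matrix τ k c)    ≡⟨ dot-column j (τ j) b (matrix σ r) ⟩
  ½ * (matrix σ r ⁺ j + sgn b * matrix σ r ⁻ τ j)
    ≡⟨ cong₂ (λ x y → ½ * (x + sgn b * y)) (plus j) (minus (τ j)) ⟩
  ½ * (I (block r) j + sgn b * (I (block r) (σ (τ j)) * sgn (side r))) ∎
  where
  j = block c
  b = side c
  plus : ∀ k → matrix σ r ⁺ k ≡ I (block r) k
  plus k = trans (cong₂ _+_ (matrix-cell σ r k 0F) (matrix-cell σ r k 1F))
    (solve 3 (λ x y z → con ½ :* (x :+ con 1ℚ :* (y :* z)) :+ con ½ :*
        (x :+ con (- 1ℚ) :* (y :* z)) := x) refl
      (I (block r) k) (I (block r) (σ k)) (sgn (side r)))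
  minus : ∀ k → matrix σ r ⁻ k ≡ I (block r) (σ k) * sgn (side r)
  minus k = trans (cong₂ _-_ (matrix-cell σ r k 0F) (matrix-cell σ r k 1F))
    (solve 3 (λ x y z → con ½ :* (x :+ con 1ℚ :* (y :* z)) :- con ½ :*
        (x :+ con (- 1ℚ) :* (y :* z)) := y :* z) refl
      (I (block r) k) (I (block r) (σ k)) (sgn (side r)))

module _ (π : Permutation′ 5) where

  I-transpose : ∀ i j → I i (π ⟨$⟩ʳ j) ≡ I j (π ⟨$⟩ˡ i)
  I-transpose i j with i ≟ π ⟨$⟩ʳ j | j ≟ π ⟨$⟩ˡ i
  ... | yes _ | yes _ = refl
  ... | no _  | no _  = refl
  ... | yes p | no ¬q = contradiction (trans (sym (Perm.inverseˡ π)) (cong (π ⟨$⟩ˡ_) (sym p))) ¬q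
  ... | no ¬p | yes q = contradiction (trans (sym (Perm.inverseʳ π)) (cong (π ⟨$⟩ʳ_) (sym q))) ¬p

  matrix-ᵀ : matrix (π ⟨$⟩ʳ_) ᵀ ≐ matrix (π ⟨$⟩ˡ_)
  matrix-ᵀ r c = begin
    ½ * (I (block c) (block r) + sgn (side r) * (I (block c) (π ⟨$⟩ʳ block r) * sgn (side c)))
      ≡⟨ cong₂ (λ x y → ½ * (x + sgn (side r) * (y * sgn (side c)))) (I-sym (block c) (block r))
          (I-transpose (block c) (block r)) ⟩
    ½ * (I (block r) (block c) + sgn (side r) * (I (block r) (π ⟨$⟩ˡ block c) * sgn (side c)))
      ≡⟨ solve 4 (λ x y s t → con ½ :* (x :+ s :* (y :* t)) := con ½ :* (x :+ t :* (y :* s))) refl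
           (I (block r) (block c)) (I (block r) (π ⟨$⟩ˡ block c)) (sgn (side r)) (sgn (side c)) ⟩
    matrix (π ⟨$⟩ˡ_) r c ∎

  private
    A = matrix (π ⟨$⟩ʳ_)
    A⁻¹ = matrix (π ⟨$⟩ˡ_)

  matrix-regularOrthogonal : IsRegularOrthogonal A
  matrix-regularOrthogonal = record
    { orthogonalˡ = ≐-trans (·-cong matrix-ᵀ (≐-refl {A = A}))
        (≐-trans (matrix-· (π ⟨$⟩ˡ_) (π ⟨$⟩ʳ_)) (≐-trans
            (matrix-cong {τ = id} λ _ → Perm.inverseˡ π) matrix-id))
    ; orthogonalʳ = ≐-trans (·-cong (≐-refl {A = A}) matrix-ᵀ)
        (≐-trans (matrix-· (π ⟨$⟩ʳ_) (π ⟨$⟩ˡ_)) (≐-trans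
            (matrix-cong {τ = id} λ _ → Perm.inverseʳ π) matrix-id))
    ; rowSums     = λ r → begin
        sum (A r)                    ≡⟨ sum-cong-≗
            (λ c → trans (matrix-ᵀ c r) (sym (ℚ.*-identityʳ (A⁻¹ c r)))) ⟩
        sum (λ c → A⁻¹ c r * 1ℚ)     ≡⟨ column-dot (block r) (π ⟨$⟩ˡ block r) (side r) (λ _ → 1ℚ) ⟩
        ½ * (1ℚ + 1ℚ + sgn (side r) * 0ℚ) ≡⟨ cong (λ x → ½ * (1ℚ + 1ℚ + x)) (ℚ.*-zeroʳ (sgn (side r))) ⟩
        1ℚ ∎
    }

-- Congruence in the Hadamard basis

-- The arguments w, x, y, z are the entries (0 , 0), (0 , 1), (1 , 0), (1 , 1) of a block; the four
-- functions are its unnormalised Hadamard coefficients.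
totalOf colDiffOf rowDiffOf crossDiffOf : (w x y z : ℚ) → ℚ
totalOf     w x y z = (w + y) + (x + z)
colDiffOf   w x y z = (w + y) - (x + z)
rowDiffOf   w x y z = (w - y) + (x - z)
crossDiffOf w x y z = (w - y) - (x - z)

onBlock : {X Y : Set} → (X → X → X → X → Y) → (Fin 10 → Fin 10 → X) → Fin 5 → Fin 5 → Y
onBlock f A i j =
  f (A (cell i 0F) (cell j 0F)) (A (cell i 0F) (cell j 1F)) (A (cell i 1F) (cell j 0F))
      (A (cell i 1F) (cell j 1F))

total colDiff rowDiff crossDiff : Matrix 10 10 → Fin 5 → Fin 5 → ℚ
total     = onBlock totalOf
colDiff   = onBlock colDiffOf
rowDiff   = onBlock rowDiffOf
crossDiff = onBlock crossDiffOf

formEntry : ℚ → ℚ → ℚ → ℚ → Fin 2 → Fin 2 → ℚ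
formEntry t c r x a b = ½ * (½ * ((t + sgn a * r) + sgn b * (c + sgn a * x)))

-- The bilinear form of B at `column i j a` and `column k l b`. Expanding ½ (1ᵢ ± δⱼ) and ½ (1ₖ ±
-- δₗ) picks one Hadamard coefficient from each of the blocks (i , k), (i , l), (j , k) and (j , l).
form : Matrix 10 10 → (i j : Fin 5) (a : Fin 2) (k l : Fin 5) (b : Fin 2) → ℚ
form B i j a k l b = formEntry (total B i k) (colDiff B i l) (rowDiff B j k) (crossDiff B j l) a b

-- Only the two columns involved are assumed to have the standard form, so the formula also covers a
-- prefix of a factorisation, whose columns may stand in any order.
congruence-entry : ∀ (S B : Matrix 10 10) {c d} i j a k l b →
  (∀ r → S r c ≡ column i j a r) → (∀ r → S r d ≡ column k l b r) →
  (S ᵀ · B · S) c d ≡ form B i j a k l b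
congruence-entry S B {c} {d} i j a k l b Sc Sd = begin
  sum (λ s → sum (λ r → S r c * B r s) * S s d)
    ≡⟨ sum-cong-≗ (λ s → cong₂ _*_ (trans (sum-cong-≗ λ r → cong (_* B r s) (Sc r))
        (column-dot i j a λ r → B r s)) (Sd s)) ⟩
  sum (λ s → half s * column k l b s)
    ≡⟨ dot-column k l b half ⟩
  ½ * (half ⁺ k + sgn b * half ⁻ l)
    ≡⟨ cong₂ (λ x y → ½ * (x + sgn b * y))
         (rearrange⁺ (sgn a) (B (i₀ i) (i₀ k)) (B (i₁ i) (i₀ k)) (B (i₀ j) (i₀ k)) (B (i₁ j) (i₀ k))
                            (B (i₀ i) (i₁ k)) (B (i₁ i) (i₁ k)) (B (i₀ j) (i₁ k)) (B (i₁ j) (i₁ k)))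
         (rearrange⁻ (sgn a) (B (i₀ i) (i₀ l)) (B (i₁ i) (i₀ l)) (B (i₀ j) (i₀ l)) (B (i₁ j) (i₀ l))
                            (B (i₀ i) (i₁ l)) (B (i₁ i) (i₁ l)) (B (i₀ j) (i₁ l)) (B (i₁ j) (i₁ l))) ⟩
  ½ * (½ * (total B i k + sgn a * rowDiff B j k) + sgn b *
      (½ * (colDiff B i l + sgn a * crossDiff B j l)))
    ≡⟨ solve 3 (λ x y s → con ½ :* (con ½ :* x :+ s :* (con ½ :* y)) := con ½ :*
        (con ½ :* (x :+ s :* y))) refl
         (total B i k + sgn a * rowDiff B j k) (colDiff B i l + sgn a * crossDiff B j l) (sgn b) ⟩
  form B i j a k l b ∎
  where
  i₀ i₁ : Fin 5 → Fin 10
  i₀ m = cell m 0F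
  i₁ m = cell m 1F
  half : Vector ℚ 10
  half s = ½ * ((λ r → B r s) ⁺ i + sgn a * (λ r → B r s) ⁻ j)
  rearrange⁺ : ∀ s p q r t p′ q′ r′ t′ →
    ½ * ((p + q) + s * (r - t)) + ½ * ((p′ + q′) + s * (r′ - t′)) ≡ ½ *
        (((p + q) + (p′ + q′)) + s * ((r - t) + (r′ - t′)))
  rearrange⁺ = solve 9 (λ s p q r t p′ q′ r′ t′ →
    con ½ :* ((p :+ q) :+ s :* (r :- t)) :+ con ½ :* ((p′ :+ q′) :+ s :* (r′ :- t′))
    := con ½ :* (((p :+ q) :+ (p′ :+ q′)) :+ s :* ((r :- t) :+ (r′ :- t′)))) refl
  rearrange⁻ : ∀ s p q r t p′ q′ r′ t′ →
    ½ * ((p + q) + s * (r - t)) - ½ * ((p′ + q′) + s * (r′ - t′)) ≡ ½ *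
        (((p + q) - (p′ + q′)) + s * ((r - t) - (r′ - t′)))
  rearrange⁻ = solve 9 (λ s p q r t p′ q′ r′ t′ →
    con ½ :* ((p :+ q) :+ s :* (r :- t)) :- con ½ :* ((p′ :+ q′) :+ s :* (r′ :- t′))
    := con ½ :* (((p :+ q) :- (p′ :+ q′)) :+ s :* ((r :- t) :- (r′ :- t′)))) refl

-- Blocks of 01-matrices

val : Bool → ℚ
val b = if b then 1ℚ else 0ℚ

val-01 : ∀ b → Is01 (val b)
val-01 false = inj₁ refl
val-01 true  = inj₂ refl

toBit : ∀ {x} → Is01 x → ∃[ b ] x ≡ val b
toBit (inj₁ x≡0) = false , x≡0
toBit (inj₂ x≡1) = true , x≡1

is01? : ∀ x → Dec (Is01 x)
is01? x = x ℚ.≟ 0ℚ ⊎-dec x ℚ.≟ 1ℚ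

all-Bool? : ∀ {p} {P : Bool → Set p} → (∀ b → Dec (P b)) → Dec (∀ b → P b)
all-Bool? P? = map′ (λ { (f , t) → λ { false → f ; true → t } }) (λ p → p false , p true)
                    (P? false ×-dec P? true)

odd : Bool → Bool → Bool → Bool → Bool
odd w x y z = (w xor y) xor (x xor z)

-- Meaningful only for blocks that are not odd.
shapeOf : Bool → Bool → Bool → Bool → Shape
shapeOf w x y z = choose (w xor y) (w xor x)
  where
  choose : Bool → Bool → Shape
  choose false false = flat
  choose true  false = row
  choose false true  = col
  choose true  true  = twist

Same : (Shape → Bool) → (w x y z w′ x′ y′ z′ : Bool) → Set
Same is w x y z w′ x′ y′ z′ =
  odd w x y z ≡ odd w′ x′ y′ z′ ×
  (odd w′ x′ y′ z′ ≡ false → is (shapeOf w x y z) ≡ is (shapeOf w′ x′ y′ z′))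

valued : (ℚ → ℚ → ℚ → ℚ → ℚ) → (w x y z : Bool) → ℚ
valued f w x y z = f (val w) (val x) (val y) (val z)

same? : ∀ is f → Dec (∀ w x y z w′ x′ y′ z′ → valued f w x y z ≡ valued f w′ x′ y′ z′ →
    Same is w x y z w′ x′ y′ z′)
same? is f =
  all-Bool? λ w → all-Bool? λ x → all-Bool? λ y → all-Bool? λ z →
  all-Bool? λ w′ → all-Bool? λ x′ → all-Bool? λ y′ → all-Bool? λ z′ →
  valued f w x y z ℚ.≟ valued f w′ x′ y′ z′ →-dec
  (odd w x y z Bool.≟ odd w′ x′ y′ z′ ×-dec
   (odd w′ x′ y′ z′ Bool.≟ false →-dec is (shapeOf w x y z) Bool.≟ is (shapeOf w′ x′ y′ z′)))

-- For a 01-block every Hadamard coefficient has the parity of the number of ones. In an even block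
-- the total is 0 or 4 for the flat shape and 2 otherwise, while each difference is 2 or -2 for its
-- own shape and 0 otherwise. Hence a single coefficient reveals the parity and, for even blocks,
-- whether the shape is the one belonging to that coefficient. The three lemmas below rest on the
-- same fact.
same-total : ∀ w x y z w′ x′ y′ z′ → valued totalOf w x y z ≡ valued totalOf w′ x′ y′ z′ →
    Same isFlat w x y z w′ x′ y′ z′
same-total = toWitness {a? = same? isFlat totalOf} tt

same-col : ∀ w x y z w′ x′ y′ z′ → valued colDiffOf w x y z ≡ valued colDiffOf w′ x′ y′ z′ →
    Same isCol w x y z w′ x′ y′ z′
same-col = toWitness {a? = same? isCol colDiffOf} tt

same-row : ∀ w x y z w′ x′ y′ z′ → valued rowDiffOf w x y z ≡ valued rowDiffOf w′ x′ y′ z′ →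
    Same isRow w x y z w′ x′ y′ z′
same-row = toWitness {a? = same? isRow rowDiffOf} tt

same-cross : ∀ w x y z w′ x′ y′ z′ → valued crossDiffOf w x y z ≡ valued crossDiffOf w′ x′ y′ z′ →
    Same isTwist w x y z w′ x′ y′ z′
same-cross = toWitness {a? = same? isTwist crossDiffOf} tt

count-shape : ∀ s → count (isFlat s) (isCol s) (isRow s) (isTwist s) ≡ 1
count-shape flat  = refl
count-shape row   = refl
count-shape col   = refl
count-shape twist = refl

Bits : Set
Bits = Fin 10 → Fin 10 → Bool

realise : Bits → Matrix 10 10
realise β r c = val (β r c)

module _ (β : Bits) (σ : Fin 5 → Fin 5)
         (integral : ∀ i a j b → Is01 (form (realise β) i (σ i) a j (σ j) b)) where

  private
    module _ (i j : Fin 5) where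
      bit′ : ∀ a b → ∃[ n ] form (realise β) i (σ i) a j (σ j) b ≡ val n
      bit′ a b = toBit (integral i a j b)
      n₀₀ = proj₁ (bit′ 0F 0F)
      n₀₁ = proj₁ (bit′ 0F 1F)
      n₁₀ = proj₁ (bit′ 1F 0F)
      n₁₁ = proj₁ (bit′ 1F 1F)
      t = total (realise β) i j
      c = colDiff (realise β) i (σ j)
      r = rowDiff (realise β) (σ i) j
      x = crossDiff (realise β) (σ i) (σ j)

      spread : (f : ℚ → ℚ → ℚ → ℚ → ℚ) →
        f (formEntry t c r x 0F 0F) (formEntry t c r x 0F 1F) (formEntry t c r x 1F 0F)
            (formEntry t c r x 1F 1F)
        ≡ valued f n₀₀ n₀₁ n₁₀ n₁₁
      spread f = trans (cong₂ (λ p q → f p q (formEntry t c r x 1F 0F) (formEntry t c r x 1F 1F))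
          (proj₂ (bit′ 0F 0F)) (proj₂ (bit′ 0F 1F)))
                       (cong₂ (λ p q → f (val n₀₀) (val n₀₁) p q) (proj₂ (bit′ 1F 0F))
                           (proj₂ (bit′ 1F 1F)))

      -- As a and b vary, `formEntry` is the inverse Hadamard transform of t, c, r, x. Transforming
      -- the new block back recovers the four coefficients it was assembled from.
      N-total : valued totalOf n₀₀ n₀₁ n₁₀ n₁₁ ≡ t
      N-total = trans (sym (spread totalOf)) (identity t c r x)
        where
        identity : ∀ t c r x → totalOf (formEntry t c r x 0F 0F) (formEntry t c r x 0F 1F)
            (formEntry t c r x 1F 0F) (formEntry t c r x 1F 1F) ≡ t
        identity = solve 4 (λ t c r x →
          let h a b = con ½ :* (con ½ :* ((t :+ a :* r) :+ b :* (c :+ a :* x))) ; p = con 1ℚ ; m = con (- 1ℚ)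
          in (h p p :+ h m p) :+ (h p m :+ h m m) := t) refl

      N-col : valued colDiffOf n₀₀ n₀₁ n₁₀ n₁₁ ≡ c
      N-col = trans (sym (spread colDiffOf)) (identity t c r x)
        where
        identity : ∀ t c r x → colDiffOf (formEntry t c r x 0F 0F) (formEntry t c r x 0F 1F)
            (formEntry t c r x 1F 0F) (formEntry t c r x 1F 1F) ≡ c
        identity = solve 4 (λ t c r x →
          let h a b = con ½ :* (con ½ :* ((t :+ a :* r) :+ b :* (c :+ a :* x))) ; p = con 1ℚ ; m = con (- 1ℚ)
          in (h p p :+ h m p) :- (h p m :+ h m m) := c) refl

      N-row : valued rowDiffOf n₀₀ n₀₁ n₁₀ n₁₁ ≡ r
      N-row = trans (sym (spread rowDiffOf)) (identity t c r x)
        where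
        identity : ∀ t c r x → rowDiffOf (formEntry t c r x 0F 0F) (formEntry t c r x 0F 1F)
            (formEntry t c r x 1F 0F) (formEntry t c r x 1F 1F) ≡ r
        identity = solve 4 (λ t c r x →
          let h a b = con ½ :* (con ½ :* ((t :+ a :* r) :+ b :* (c :+ a :* x))) ; p = con 1ℚ ; m = con (- 1ℚ)
          in (h p p :- h m p) :+ (h p m :- h m m) := r) refl

      N-cross : valued crossDiffOf n₀₀ n₀₁ n₁₀ n₁₁ ≡ x
      N-cross = trans (sym (spread crossDiffOf)) (identity t c r x)
        where
        identity : ∀ t c r x → crossDiffOf (formEntry t c r x 0F 0F) (formEntry t c r x 0F 1F)
            (formEntry t c r x 1F 0F) (formEntry t c r x 1F 1F) ≡ x
        identity = solve 4 (λ t c r x →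
          let h a b = con ½ :* (con ½ :* ((t :+ a :* r) :+ b :* (c :+ a :* x))) ; p = con 1ℚ ; m = con (- 1ℚ)
          in (h p p :- h m p) :- (h p m :- h m m) := x) refl

      new : Shape
      new = shapeOf n₀₀ n₀₁ n₁₀ n₁₁

      S-total : odd n₀₀ n₀₁ n₁₀ n₁₁ ≡ onBlock odd β i j ×
              (onBlock odd β i j ≡ false → isFlat new ≡ isFlat (onBlock shapeOf β i j))
      S-total = same-total n₀₀ n₀₁ n₁₀ n₁₁ (β (cell i 0F) (cell j 0F)) (β (cell i 0F) (cell j 1F))
          (β (cell i 1F) (cell j 0F)) (β (cell i 1F) (cell j 1F)) N-total

      S-col : odd n₀₀ n₀₁ n₁₀ n₁₁ ≡ onBlock odd β i (σ j) ×
              (onBlock odd β i (σ j) ≡ false → isCol new ≡ isCol (onBlock shapeOf β i (σ j)))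
      S-col = same-col n₀₀ n₀₁ n₁₀ n₁₁ (β (cell i 0F) (cell (σ j) 0F)) (β (cell i 0F) (cell (σ j) 1F))
          (β (cell i 1F) (cell (σ j) 0F)) (β (cell i 1F) (cell (σ j) 1F)) N-col

      S-row : odd n₀₀ n₀₁ n₁₀ n₁₁ ≡ onBlock odd β (σ i) j ×
              (onBlock odd β (σ i) j ≡ false → isRow new ≡ isRow (onBlock shapeOf β (σ i) j))
      S-row = same-row n₀₀ n₀₁ n₁₀ n₁₁ (β (cell (σ i) 0F) (cell j 0F)) (β (cell (σ i) 0F) (cell j 1F))
          (β (cell (σ i) 1F) (cell j 0F)) (β (cell (σ i) 1F) (cell j 1F)) N-row

      S-cross : odd n₀₀ n₀₁ n₁₀ n₁₁ ≡ onBlock odd β (σ i) (σ j) ×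
              (onBlock odd β (σ i) (σ j) ≡ false → isTwist new ≡ isTwist
                  (onBlock shapeOf β (σ i) (σ j)))
      S-cross = same-cross n₀₀ n₀₁ n₁₀ n₁₁ (β (cell (σ i) 0F) (cell (σ j) 0F))
          (β (cell (σ i) 0F) (cell (σ j) 1F)) (β (cell (σ i) 1F) (cell (σ j) 0F))
              (β (cell (σ i) 1F) (cell (σ j) 1F)) N-cross

  -- The new block (i , j) takes its total from one of these blocks and its column difference from
  -- the other, and either coefficient fixes its parity.
  parity-transport : ∀ i j → onBlock odd β i j ≡ onBlock odd β i (σ j)
  parity-transport i j = trans (sym (proj₁ (S-total i j))) (proj₁ (S-col i j))

  -- The new block has exactly one shape, so exactly one of its four indicators holds. Each
  -- indicator can be read off the block of B that supplied the corresponding coefficient.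
  even⇒coherent : (∀ i j → onBlock odd β i j ≡ false) → Coherent (onBlock shapeOf β) σ
  even⇒coherent even i j = subst (_≡ 1)
    (cong₄ count (proj₂ (S-total i j) (even i j)) (proj₂ (S-col i j) (even i (σ j)))
                 (proj₂ (S-row i j) (even (σ i) j)) (proj₂ (S-cross i j) (even (σ i) (σ j))))
    (count-shape (new i j))
    where
    cong₄ : {X : Set} (f : Bool → Bool → Bool → Bool → X) {p q r s p′ q′ r′ s′ : Bool} →
            p ≡ p′ → q ≡ q′ → r ≡ r′ → s ≡ s′ → f p q r s ≡ f p′ q′ r′ s′
    cong₄ f refl refl refl refl = refl

cong₄ : {X Y : Set} (f : X → X → X → X → Y) {p q r s p′ q′ r′ s′ : X} →
        p ≡ p′ → q ≡ q′ → r ≡ r′ → s ≡ s′ → f p q r s ≡ f p′ q′ r′ s′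
cong₄ f refl refl refl refl = refl

-- Matrices given by shapes and corner entries

bit : Fin 2 → Bool
bit 0F = false
bit 1F = true

mask : Shape → Fin 2 → Fin 2 → Bool
mask flat  a b = false
mask row   a b = bit a
mask col   a b = bit b
mask twist a b = bit a xor bit b

entryBit : Shape → Bool → Fin 2 → Fin 2 → Bool
entryBit s e a b = e xor mask s a b

-- Since every mask vanishes at (0 , 0), a flip is the top left entry of its block. Shapes and flips
-- together determine a matrix with even blocks.
Flips : Set
Flips = Fin 5 → Fin 5 → Bool

pattern-bits : Pattern → Flips → Bits
pattern-bits A e r c = entryBit (A (block r) (block c)) (e (block r) (block c)) (side r) (side c)

patterned : Pattern → Flips → Matrix 10 10
patterned A e = realise (pattern-bits A e)

-- The adjacency conditions on the level of blocks: transposition exchanges `row` and `col`, and a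
-- symmetric block with zero diagonal is either zero or the exchange matrix, hence flat or twisted
-- with zero corner.
record WellFormed (A : Pattern) (e : Flips) : Set where
  field
    pattern-symmetric : ∀ i j → A j i ≡ swap (A i j)
    pattern-diagonal  : ∀ i → A i i ≡ flat ⊎ A i i ≡ twist
    flips-symmetric   : ∀ i j → e j i ≡ e i j
    flips-diagonal    : ∀ i → e i i ≡ false

pattern-cell : ∀ A e i a j b → pattern-bits A e (cell i a) (cell j b) ≡ entryBit (A i j) (e i j) a b
pattern-cell A e i a j b =
  trans (cong₂ (λ k l → entryBit (A k l) (e k l) (side (cell i a)) (side (cell j b))) (block-cell i a)
      (block-cell j b))
        (cong₂ (entryBit (A i j) (e i j)) (side-cell i a) (side-cell j b))

mask-swap : ∀ s a b → mask (swap s) b a ≡ mask s a b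
mask-swap flat  a b = refl
mask-swap row   a b = refl
mask-swap col   a b = refl
mask-swap twist a b = Bool.xor-comm (bit b) (bit a)

module _ {A e} (wf : WellFormed A e) where
  open WellFormed wf

  patterned-symmetric : patterned A e ᵀ ≐ patterned A e
  patterned-symmetric r c = cong val (begin
    e j i xor mask (A j i) b a         ≡⟨ cong₂ (λ f s → f xor mask s b a) (flips-symmetric i j)
        (pattern-symmetric i j) ⟩
    e i j xor mask (swap (A i j)) b a  ≡⟨ cong (e i j xor_) (mask-swap (A i j) a b) ⟩
    e i j xor mask (A i j) a b         ∎)
    where
    i = block r
    j = block c
    a = side r
    b = side c

  patterned-adjacency : IsAdjacency (patterned A e)
  patterned-adjacency = record
    { symmetric    = patterned-symmetric
    ; entries01    = λ r c → val-01 (pattern-bits A e r c)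
    ; zeroDiagonal = λ r → cong val (zero-diagonal (block r) (side r))
    }
    where
    zero-diagonal : ∀ i a → e i i xor mask (A i i) a a ≡ false
    zero-diagonal i a with e i i | flips-diagonal i | A i i | pattern-diagonal i
    ... | _ | refl | _ | inj₁ refl = refl
    ... | _ | refl | _ | inj₂ refl = Bool.xor-same (bit a)

private
  totalVal diffVal : Bool → Bool → ℚ
  totalVal true  e = val e + val e + (val e + val e)
  totalVal false e = 1ℚ + 1ℚ
  diffVal true  e = if e then 1ℚ + 1ℚ else - (1ℚ + 1ℚ)
  diffVal false e = 0ℚ

  on-entry : (ℚ → ℚ → ℚ → ℚ → ℚ) → Shape → Bool → ℚ
  on-entry f s e = f (val (entryBit s e 0F 0F)) (val (entryBit s e 0F 1F)) (val (entryBit s e 1F 0F))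
      (val (entryBit s e 1F 1F))

  total-entry : ∀ s e → on-entry totalOf s e ≡ totalVal (isFlat s) e
  total-entry = toWitness {a? = all-Shape? λ s → all-Bool? λ e → on-entry totalOf s e ℚ.≟ totalVal
      (isFlat s) e} tt

  col-entry : ∀ s e → on-entry colDiffOf s e ≡ diffVal (isCol s) e
  col-entry = toWitness {a? = all-Shape? λ s → all-Bool? λ e → on-entry colDiffOf s e ℚ.≟ diffVal
      (isCol s) e} tt

  row-entry : ∀ s e → on-entry rowDiffOf s e ≡ diffVal (isRow s) e
  row-entry = toWitness {a? = all-Shape? λ s → all-Bool? λ e → on-entry rowDiffOf s e ℚ.≟ diffVal
      (isRow s) e} tt

  cross-entry : ∀ s e → on-entry crossDiffOf s e ≡ diffVal (isTwist s) e
  cross-entry = toWitness {a? = all-Shape? λ s → all-Bool? λ e → on-entry crossDiffOf s e ℚ.≟ diffVal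
      (isTwist s) e} tt

  on-pattern : ∀ f A e i j → onBlock f (patterned A e) i j ≡ on-entry f (A i j) (e i j)
  on-pattern f A e i j =
    trans (cong₂ (λ p q → f p q (B 1F 0F) (B 1F 1F)) (at 0F 0F) (at 0F 1F))
          (cong₂ (λ p q → f (val (entryBit (A i j) (e i j) 0F 0F))
              (val (entryBit (A i j) (e i j) 0F 1F)) p q) (at 1F 0F) (at 1F 1F))
    where
    B : Fin 2 → Fin 2 → ℚ
    B a b = patterned A e (cell i a) (cell j b)
    at : ∀ a b → B a b ≡ val (entryBit (A i j) (e i j) a b)
    at a b = cong val (pattern-cell A e i a j b)

  -- If the total is the distinguished coefficient, it is 0 or 4 and the differences vanish.
  -- Otherwise it is 2 and a single difference equals 2 or -2. Both cases leave 0 or 4 before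
  -- division by 4.
  entry-01 : ∀ f c r x → count f c r x ≡ 1 → ∀ e₁ e₂ e₃ e₄ a b →
             Is01 (formEntry (totalVal f e₁) (diffVal c e₂) (diffVal r e₃) (diffVal x e₄) a b)
  entry-01 = toWitness {a? =
    all-Bool? λ f → all-Bool? λ c → all-Bool? λ r → all-Bool? λ x → (count f c r x ℕ.≟ 1) →-dec
    all-Bool? λ e₁ → all-Bool? λ e₂ → all-Bool? λ e₃ → all-Bool? λ e₄ → all? λ a → all? λ b →
    is01? (formEntry (totalVal f e₁) (diffVal c e₂) (diffVal r e₃) (diffVal x e₄) a b)} tt

  -- With equal column and row indicators, a count of 1 excludes both. What remains is a total of 0,
  -- or a total of 2 together with a cross difference of -2; the latter enters with sign
  -- `sgn a * sgn a`, which is 1.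
  entry-diagonal : ∀ f c x → count f c c x ≡ 1 → ∀ e₂ e₃ a →
                   formEntry (totalVal f false) (diffVal c e₂) (diffVal c e₃) (diffVal x false) a a ≡ 0ℚ
  entry-diagonal = toWitness {a? =
    all-Bool? λ f → all-Bool? λ c → all-Bool? λ x → (count f c c x ℕ.≟ 1) →-dec
    all-Bool? λ e₂ → all-Bool? λ e₃ → all? λ a →
    formEntry (totalVal f false) (diffVal c e₂) (diffVal c e₃) (diffVal x false) a a ℚ.≟ 0ℚ} tt

form-pattern : ∀ A e i j a k l b →
  form (patterned A e) i j a k l b ≡
  formEntry (totalVal (isFlat (A i k)) (e i k)) (diffVal (isCol (A i l)) (e i l))
            (diffVal (isRow (A j k)) (e j k)) (diffVal (isTwist (A j l)) (e j l)) a b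
form-pattern A e i j a k l b = cong₄ (λ t c r x → formEntry t c r x a b)
  (trans (on-pattern totalOf A e i k) (total-entry (A i k) (e i k)))
  (trans (on-pattern colDiffOf A e i l) (col-entry (A i l) (e i l)))
  (trans (on-pattern rowDiffOf A e j k) (row-entry (A j k) (e j k)))
  (trans (on-pattern crossDiffOf A e j l) (cross-entry (A j l) (e j l)))

isRow-swap : ∀ s → isRow (swap s) ≡ isCol s
isRow-swap flat  = refl
isRow-swap row   = refl
isRow-swap col   = refl
isRow-swap twist = refl

opaque
  coherent⇒adjacency : ∀ {A e} → WellFormed A e → ∀ {σ} → Coherent A σ →
                       IsAdjacency (matrix σ ᵀ · patterned A e · matrix σ)
  coherent⇒adjacency {A} {e} wf {σ} coherent = record
    { symmetric    = congruence-symmetric (matrix σ) (patterned A e) (patterned-symmetric wf)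
    ; entries01    = λ r c → let i = block r ; j = block c in
        subst Is01 (sym (trans (entry r c) (form-pattern A e i (σ i) (side r) j (σ j) (side c))))
          (entry-01 (isFlat (A i j)) (isCol (A i (σ j))) (isRow (A (σ i) j)) (isTwist (A (σ i) (σ j)))
              (coherent i j) (e i j) (e i (σ j)) (e (σ i) j) (e (σ i) (σ j)) (side r) (side c))
    ; zeroDiagonal = λ r → let i = block r in
        trans (trans (entry r r) (form-pattern A e i (σ i) (side r) i (σ i) (side r)))
            (diagonal i (side r))
    }
    where
    open WellFormed wf
    entry : ∀ r c → (matrix σ ᵀ · patterned A e · matrix σ) r c ≡
                    form (patterned A e) (block r) (σ (block r)) (side r) (block c) (σ (block c))
                        (side c)
    entry r c = congruence-entry (matrix σ) (patterned A e) {r} {c}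
      (block r) (σ (block r)) (side r) (block c) (σ (block c)) (side c) (λ _ → refl) (λ _ → refl)

    diagonal : ∀ i a →
      formEntry (totalVal (isFlat (A i i)) (e i i)) (diffVal (isCol (A i (σ i))) (e i (σ i)))
                (diffVal (isRow (A (σ i) i)) (e (σ i) i))
                    (diffVal (isTwist (A (σ i) (σ i))) (e (σ i) (σ i))) a a ≡ 0ℚ
    diagonal i a = trans
      (cong₄ (λ t c r x → formEntry t c r x a a)
        (cong (totalVal (isFlat (A i i))) (flips-diagonal i))
            (refl {x = diffVal (isCol (A i (σ i))) (e i (σ i))})
        (cong (λ s → diffVal s (e (σ i) i)) row≡col)
        (cong (diffVal (isTwist (A (σ i) (σ i)))) (flips-diagonal (σ i))))
      (entry-diagonal (isFlat (A i i)) (isCol (A i (σ i))) (isTwist (A (σ i) (σ i)))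
        (subst (λ s → count (isFlat (A i i)) (isCol (A i (σ i))) s (isTwist (A (σ i) (σ i))) ≡ 1)
            row≡col (coherent i i))
        (e i (σ i)) (e (σ i) i) a)
      where
      row≡col : isRow (A (σ i) i) ≡ isCol (A i (σ i))
      row≡col = trans (cong isRow (pattern-symmetric i (σ i))) (isRow-swap (A i (σ i)))

opaque
  coherent⇒𝓑 : ∀ {A e} → WellFormed A e → Coherent A next → 𝓑 R₁₀ (patterned A e)
  coherent⇒𝓑 {A} {e} wf coherent = patterned-adjacency wf ,
    isAdjacency-resp (congruence-cong (≐-sym R₁₀≐matrix) (≐-refl {A = patterned A e}))
        (coherent⇒adjacency wf coherent)

next-induction : (P : Fin 5 → Set) → (∀ i → P i → P (next i)) → ∀ {k} → P k → ∀ i → P i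
next-induction P step {k} p = from-zero (to-zero k p)
  where
  to-zero : ∀ k → P k → P 0F
  to-zero 0F p = p
  to-zero 1F p = step 4F (step 3F (step 2F (step 1F p)))
  to-zero 2F p = step 4F (step 3F (step 2F p))
  to-zero 3F p = step 4F (step 3F p)
  to-zero 4F p = step 4F p
  from-zero : P 0F → ∀ i → P i
  from-zero p 0F = p
  from-zero p 1F = step 0F p
  from-zero p 2F = step 1F (step 0F p)
  from-zero p 3F = step 2F (step 1F (step 0F p))
  from-zero p 4F = step 3F (step 2F (step 1F (step 0F p)))

even-block : ∀ w x y z → odd w x y z ≡ false →
  w ≡ entryBit (shapeOf w x y z) w 0F 0F × x ≡ entryBit (shapeOf w x y z) w 0F 1F ×
  y ≡ entryBit (shapeOf w x y z) w 1F 0F × z ≡ entryBit (shapeOf w x y z) w 1F 1F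
even-block = toWitness {a? =
  all-Bool? λ w → all-Bool? λ x → all-Bool? λ y → all-Bool? λ z → (odd w x y z Bool.≟ false) →-dec
  let s = shapeOf w x y z in
  (w Bool.≟ entryBit s w 0F 0F) ×-dec (x Bool.≟ entryBit s w 0F 1F) ×-dec
  (y Bool.≟ entryBit s w 1F 0F) ×-dec (z Bool.≟ entryBit s w 1F 1F)} tt

shapeOf-swap : ∀ w x y z → shapeOf w y x z ≡ swap (shapeOf w x y z)
shapeOf-swap = toWitness {a? =
  all-Bool? λ w → all-Bool? λ x → all-Bool? λ y → all-Bool? λ z → shapeOf w y x z ≟ˢ swap
      (shapeOf w x y z)} tt

shapeOf-diagonal : ∀ x → shapeOf false x x false ≡ flat ⊎ shapeOf false x x false ≡ twist
shapeOf-diagonal false = inj₁ refl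
shapeOf-diagonal true  = inj₂ refl

odd-diagonal : ∀ x → odd false x x false ≡ false
odd-diagonal false = refl
odd-diagonal true  = refl

val-injective : ∀ {b c} → val b ≡ val c → b ≡ c
val-injective {false} {false} _ = refl
val-injective {true}  {true}  _ = refl
val-injective {false} {true}  ()
val-injective {true}  {false} ()

cell-elim : (P : Fin 10 → Set) → (∀ i a → P (cell i a)) → ∀ r → P r
cell-elim P p r = subst P (cell-block-side r) (p (block r) (side r))

form-integral : ∀ (S : Matrix 10 10) {σ} β → S ≐ matrix σ → (∀ r c → Is01 ((S ᵀ · realise β · S) r c)) →
                ∀ i a j b → Is01 (form (realise β) i (σ i) a j (σ j) b)
form-integral S {σ} β S≐ entries i a j b =
  subst Is01 (congruence-entry S (realise β) i (σ i) a j (σ j) b (at i a) (at j b))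
      (entries (cell i a) (cell j b))
  where
  at : ∀ i a r → S r (cell i a) ≡ column i (σ i) a r
  at i a r = trans (S≐ r (cell i a)) (matrix-cell σ r i a)

record PatternOf (B : Matrix 10 10) : Set where
  field
    shapes     : Pattern
    flips      : Flips
    wellFormed : WellFormed shapes flips
    coherent   : Coherent shapes next
    realises   : B ≐ patterned shapes flips

𝓑⇒pattern : ∀ {B} → 𝓑 R₁₀ B → PatternOf B
𝓑⇒pattern {B} (adj , adj′) = record
  { shapes     = onBlock shapeOf β
  ; flips      = λ i j → β (cell i 0F) (cell j 0F)
  ; wellFormed = record
    { pattern-symmetric = λ i j → trans
        (cong₄ shapeOf (β-symmetric (cell i 0F) (cell j 0F)) (β-symmetric (cell i 1F) (cell j 0F))
            (β-symmetric (cell i 0F) (cell j 1F)) (β-symmetric (cell i 1F) (cell j 1F)))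
        (shapeOf-swap (β (cell i 0F) (cell j 0F)) (β (cell i 0F) (cell j 1F))
            (β (cell i 1F) (cell j 0F)) (β (cell i 1F) (cell j 1F)))
    ; pattern-diagonal  = λ i → subst (λ s → s ≡ flat ⊎ s ≡ twist)
        (sym (cong₄ shapeOf (β-diagonal (cell i 0F)) (refl {x = β (cell i 0F) (cell i 1F)})
            (β-symmetric (cell i 0F) (cell i 1F)) (β-diagonal (cell i 1F))))
        (shapeOf-diagonal (β (cell i 0F) (cell i 1F)))
    ; flips-symmetric   = λ i j → β-symmetric (cell i 0F) (cell j 0F)
    ; flips-diagonal    = λ i → β-diagonal (cell i 0F)
    }
  ; coherent   = even⇒coherent β next integral even
  ; realises   = λ r c → trans (B≐β r c) (cong val (decode r c))
  }
  where
  open IsAdjacency adj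
  β : Bits
  β r c = proj₁ (toBit (entries01 r c))

  B≐β : B ≐ realise β
  B≐β r c = proj₂ (toBit (entries01 r c))

  β-symmetric : ∀ r c → β c r ≡ β r c
  β-symmetric r c = val-injective (trans (sym (B≐β c r)) (trans (symmetric r c) (B≐β r c)))

  β-diagonal : ∀ r → β r r ≡ false
  β-diagonal r = val-injective {β r r} {false} (trans (sym (B≐β r r)) (zeroDiagonal r))

  integral : ∀ i a j b → Is01 (form (realise β) i (next i) a j (next j) b)
  integral = form-integral R₁₀ {next} β R₁₀≐matrix
    (IsAdjacency.entries01 (isAdjacency-resp (congruence-cong (≐-refl {A = R₁₀}) B≐β) adj′))

  -- The diagonal block has two zeros and, by symmetry, two equal entries, so it is even. Parity
  -- transport along the 5-cycle then covers the whole block row.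
  even : ∀ i j → onBlock odd β i j ≡ false
  even i = next-induction (λ j → onBlock odd β i j ≡ false)
    (λ j even → trans (sym (parity-transport β next integral i j)) even) {i}
    (trans (cong₄ odd (β-diagonal (cell i 0F)) (refl {x = β (cell i 0F) (cell i 1F)})
        (β-symmetric (cell i 0F) (cell i 1F)) (β-diagonal (cell i 1F)))
           (odd-diagonal (β (cell i 0F) (cell i 1F))))

  A = onBlock shapeOf β
  e : Flips
  e i j = β (cell i 0F) (cell j 0F)

  decode : ∀ r c → β r c ≡ pattern-bits A e r c
  decode = cell-elim (λ r → ∀ c → β r c ≡ pattern-bits A e r c) λ i a →
           cell-elim (λ c → β (cell i a) c ≡ pattern-bits A e (cell i a) c) λ j b →
           trans (cases i j a b) (sym (pattern-cell A e i a j b))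
    where
    spread : ∀ {w x y z s e} (f : Fin 2 → Fin 2 → Bool) → f 0F 0F ≡ w → f 0F 1F ≡ x → f 1F 0F ≡ y →
        f 1F 1F ≡ z →
             w ≡ entryBit s e 0F 0F × x ≡ entryBit s e 0F 1F × y ≡ entryBit s e 1F 0F × z ≡
                 entryBit s e 1F 1F →
             ∀ a b → f a b ≡ entryBit s e a b
    spread f refl refl refl refl (p , q , r , s) 0F 0F = p
    spread f refl refl refl refl (p , q , r , s) 0F 1F = q
    spread f refl refl refl refl (p , q , r , s) 1F 0F = r
    spread f refl refl refl refl (p , q , r , s) 1F 1F = s

    cases : ∀ i j a b → β (cell i a) (cell j b) ≡ entryBit (A i j) (e i j) a b
    cases i j = spread {s = A i j} {e i j} (λ a b → β (cell i a) (cell j b)) refl refl refl refl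
      (even-block (β (cell i 0F) (cell j 0F)) (β (cell i 0F) (cell j 1F)) (β (cell i 1F) (cell j 0F))
          (β (cell i 1F) (cell j 1F)) (even i j))

private
  half-sum : (w x y z : Bool) → Fin 2 → ℚ
  half-sum w x y z b = ½ * ((val w + val x) + sgn b * (val y - val z))

  -- Equal parities make the half-sum an integer. In the even case the difference is 0 and the sum 0
  -- or 2; in the odd case the sum is 1 and the difference 1 or -1.
  balanced⇒01 : ∀ w x y z → w xor x ≡ y xor z → ∀ b → Is01 (half-sum w x y z b)
  balanced⇒01 = toWitness {a? =
    all-Bool? λ w → all-Bool? λ x → all-Bool? λ y → all-Bool? λ z → ((w xor x) Bool.≟ (y xor z)) →-dec
    all? λ b → is01? (half-sum w x y z b)} tt

  01⇒balanced : ∀ w x y z → (∀ b → Is01 (half-sum w x y z b)) → w xor x ≡ y xor z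
  01⇒balanced = toWitness {a? =
    all-Bool? λ w → all-Bool? λ x → all-Bool? λ y → all-Bool? λ z →
    (all? λ b → is01? (half-sum w x y z b)) →-dec ((w xor x) Bool.≟ (y xor z))} tt

-- Factorisations of R₁₀

parity : (Fin 10 → Bool) → Fin 5 → Bool
parity u i = u (cell i 0F) xor u (cell i 1F)

Uniform : (Fin 10 → Bool) → Set
Uniform u = ∀ i j → parity u i ≡ parity u j

-- An entry of the image involves only the sum over block i and the difference over block σ i, and
-- uniformity aligns the parities of any two blocks. Every σ is therefore compatible with every
-- admissible border.
uniform⇒01 : ∀ u → Uniform u → ∀ σ c → Is01 ((matrix σ ᵀ ·ᵛ (val ∘ u)) c)
uniform⇒01 u uniform σ c = subst Is01 (sym (column-dot i j (side c) (val ∘ u)))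
  (balanced⇒01 (u (cell i 0F)) (u (cell i 1F)) (u (cell j 0F)) (u (cell j 1F)) (uniform i j) (side c))
  where
  i = block c
  j = σ (block c)

·ᵛ-cong : {A A′ : Matrix 10 10} {v v′ : Vector ℚ 10} → A ≐ A′ → (∀ i → v i ≡ v′ i) → ∀ i → (A ·ᵛ v) i ≡
    (A′ ·ᵛ v′) i
·ᵛ-cong A≐A′ v≗v′ i = sum-cong-≗ λ j → cong₂ _*_ (A≐A′ i j) (v≗v′ j)

uniform⇒𝓥 : ∀ u → Uniform u → 𝓥 R₁₀ (val ∘ u)
uniform⇒𝓥 u uniform = (λ i → val-01 (u i)) ,
  λ c → subst Is01 (·ᵛ-cong {A = matrix next ᵀ} {v = val ∘ u} (λ i j → sym (R₁₀≐matrix j i))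
      (λ _ → refl) c)
                   (uniform⇒01 u uniform next c)

𝓥⇒uniform : ∀ {v} → 𝓥 R₁₀ v → Σ[ u ∈ (Fin 10 → Bool) ] (∀ r → v r ≡ val (u r)) × Uniform u
𝓥⇒uniform {v} (v01 , Rv01) = u , v≗u , uniform
  where
  u : Fin 10 → Bool
  u r = proj₁ (toBit (v01 r))
  v≗u : ∀ r → v r ≡ val (u r)
  v≗u r = proj₂ (toBit (v01 r))

  step : ∀ i → parity u i ≡ parity u (next i)
  step i = 01⇒balanced (u (cell i 0F)) (u (cell i 1F)) (u (cell (next i) 0F))
      (u (cell (next i) 1F)) λ b → subst Is01 (begin
    (R₁₀ ᵀ ·ᵛ v) (cell i b)
      ≡⟨ sum-cong-≗ (λ r → cong₂ _*_ (trans (R₁₀≐matrix r (cell i b)) (matrix-cell next r i b))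
          (v≗u r)) ⟩
    sum (λ r → column i (next i) b r * val (u r))
      ≡⟨ column-dot i (next i) b (val ∘ u) ⟩
    half-sum (u (cell i 0F)) (u (cell i 1F)) (u (cell (next i) 0F)) (u (cell (next i) 1F)) b ∎)
        (Rv01 (cell i b))

  uniform : Uniform u
  uniform i = next-induction (λ j → parity u i ≡ parity u j) (λ j eq → trans eq (step j)) {i} refl

-- Decomposability and level of block permutation matrices

block-less : ∀ (k : Fin 3) r → (toℕ r ℕ.< 2 ℕ.* toℕ k → toℕ (block r) ℕ.< toℕ k) ×
    (2 ℕ.* toℕ k ℕ.≤ toℕ r → toℕ k ℕ.≤ toℕ (block r))
block-less = toWitness {a? = all? λ k → all? λ r →
  ((toℕ r ℕ.<? 2 ℕ.* toℕ k) →-dec (toℕ (block r) ℕ.<? toℕ k)) ×-dec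
      ((2 ℕ.* toℕ k ℕ.≤? toℕ r) →-dec (toℕ k ℕ.≤? toℕ (block r)))} tt

lift : Permutation′ 5 → Permutation′ 10
lift π = permutation (apply (π ⟨$⟩ʳ_)) (apply (π ⟨$⟩ˡ_))
  (inverse (π ⟨$⟩ʳ_) (π ⟨$⟩ˡ_) (λ _ → Perm.inverseʳ π))
      (inverse (π ⟨$⟩ˡ_) (π ⟨$⟩ʳ_) (λ _ → Perm.inverseˡ π))
  where
  apply : (Fin 5 → Fin 5) → Fin 10 → Fin 10
  apply f r = cell (f (block r)) (side r)
  inverse : ∀ f g → (∀ i → f (g i) ≡ i) → ∀ r → apply f (apply g r) ≡ r
  inverse f g fg r = trans
    (cong₂ (λ i b → cell (f i) b) (block-cell (g (block r)) (side r))
        (side-cell (g (block r)) (side r)))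
    (trans (cong (λ i → cell i (side r)) (fg (block r))) (cell-block-side r))

-- The first k indices in the order given by κ form a set preserved by σ, so that no column ½ (1ⱼ ±
-- δ_(σ j)) has support on both sides of the cut.
Separates : Permutation′ 5 → ℕ → (Fin 5 → Fin 5) → Set
Separates κ k σ = ∀ i j → (toℕ i ℕ.< k × k ℕ.≤ toℕ j) ⊎ (k ℕ.≤ toℕ i × toℕ j ℕ.< k) →
                  κ ⟨$⟩ʳ i ≢ κ ⟨$⟩ʳ j × κ ⟨$⟩ʳ i ≢ σ (κ ⟨$⟩ʳ j)

-- The images of {0} and {0 , 1} run through all singletons and all pairs. This is enough for a
-- search, because a proper non-empty invariant subset of five points or its complement has at most
-- two elements.
arrange : Fin 5 → Fin 5 → Permutation′ 5
arrange p q = transpose 1F q ∘ₚ transpose 0F p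

Splits : (Fin 5 → Fin 5) → Set
Splits σ = (∃[ p ] ∃[ q ] Σ[ k ∈ Fin 2 ] Separates (arrange p q) (toℕ (suc k)) σ) × ∃[ i ] σ i ≢ i

separates? : ∀ κ k σ → Dec (Separates κ k σ)
separates? κ k σ = all? λ i → all? λ j →
  (((toℕ i ℕ.<? k) ×-dec (k ℕ.≤? toℕ j)) ⊎-dec ((k ℕ.≤? toℕ i) ×-dec (toℕ j ℕ.<? k))) →-dec
  (¬? (κ ⟨$⟩ʳ i ≟ κ ⟨$⟩ʳ j) ×-dec ¬? (κ ⟨$⟩ʳ i ≟ σ (κ ⟨$⟩ʳ j)))

splits? : ∀ σ → Dec (Splits σ)
splits? σ = (any? λ p → any? λ q → any? λ (k : Fin 2) → separates? (arrange p q) (toℕ (suc k)) σ) ×-dec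
    any? λ i → ¬? (σ i ≟ i)

matrix-decomposable : ∀ κ (k : Fin 2) {σ} → Separates κ (toℕ (suc k)) σ → Decomposable (matrix σ)
matrix-decomposable κ k {σ} separates = lift κ , lift κ , 2 ℕ.* toℕ (suc k) , ℕ.z<s , bound k , zeros
  where
  bound : (k : Fin 2) → 2 ℕ.* toℕ (suc k) ℕ.< 10
  bound = toWitness {a? = all? λ (k : Fin 2) → 2 ℕ.* toℕ (suc k) ℕ.<? 10} tt
  zeros : ∀ r c → (toℕ r ℕ.< 2 ℕ.* toℕ (suc k) × 2 ℕ.* toℕ (suc k) ℕ.≤ toℕ c) ⊎
      (2 ℕ.* toℕ (suc k) ℕ.≤ toℕ r × toℕ c ℕ.< 2 ℕ.* toℕ (suc k)) →
          matrix σ (lift κ ⟨$⟩ʳ r) (lift κ ⟨$⟩ʳ c) ≡ 0ℚ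
  zeros r c apart = begin
    matrix σ (cell i a) (cell j b)                   ≡⟨ matrix-cell σ (cell i a) j b ⟩
    column j (σ j) b (cell i a)                      ≡⟨ column-cell j (σ j) b i a ⟩
    ½ * (I i j + sgn b * (I i (σ j) * sgn a))
      ≡⟨ cong₂ (λ x y → ½ * (x + sgn b * (y * sgn a))) (I-off (proj₁ distinct))
          (I-off (proj₂ distinct)) ⟩
    ½ * (0ℚ + sgn b * (0ℚ * sgn a))
      ≡⟨ solve 2 (λ s t → con ½ :* (con 0ℚ :+ s :* (con 0ℚ :* t)) := con 0ℚ) refl (sgn b) (sgn a) ⟩
    0ℚ ∎
    where
    i = κ ⟨$⟩ʳ block r
    j = κ ⟨$⟩ʳ block c
    a = side r
    b = side c
    distinct = separates (block r) (block c)
      (Sum.map (λ (p , q) → proj₁ (block-less (suc k) r) p , proj₂ (block-less (suc k) c) q)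
               (λ (p , q) → proj₂ (block-less (suc k) r) p , proj₁ (block-less (suc k) c) q) apart)

½-not-integral : ∀ z → ½ ≢ z ℚ./ 1
½-not-integral z eq with ℚ./-injective-≃ (mkℚᵘ (ℤ.+ 1) 1) (mkℚᵘ z 0) eq
... | *≡* 1≡z*2 = odd≢even z 1≡z*2
  where
  odd≢even : ∀ z → ℤ.+ 1 ℤ.* ℤ.+ 1 ≢ z ℤ.* ℤ.+ 2
  odd≢even (ℤ.+ zero) ()
  odd≢even (ℤ.+ suc n) ()
  odd≢even (-[1+ n ]) ()

matrix-level : ∀ {σ i} → σ i ≢ i → IsLevel (matrix σ) 2
matrix-level {σ} {i} σi≢i = record
  { positive = ℕ.z<s
  ; integral = λ r c → map₂′ (doubled (does (block r ≟ block c)) (does (block r ≟ σ (block c))) (side c)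
      (side r))
  ; minimal  = minimal
  }
  where
  -- Twice an entry is one of -1, 0, 1, 2, which is `Fin 4` shifted down by 1.
  doubled : ∀ p q a b → ∃[ n ] (ℤ.+ 2 ℚ./ 1) * (½ * (val p + sgn a * (val q * sgn b))) ≡
      (toℕ {4} n ⊖ 1) ℚ./ 1
  doubled = toWitness {a? = all-Bool? λ p → all-Bool? λ q → all? λ a → all? λ b → any? λ (n : Fin 4) →
    (ℤ.+ 2 ℚ./ 1) * (½ * (val p + sgn a * (val q * sgn b))) ℚ.≟ (toℕ n ⊖ 1) ℚ./ 1} tt

  map₂′ : ∀ {x : ℚ} → (∃[ n ] x ≡ (toℕ {4} n ⊖ 1) ℚ./ 1) → ∃[ z ] x ≡ z ℚ./ 1
  map₂′ (n , eq) = toℕ n ⊖ 1 , eq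

  half : (ℤ.+ 1 ℚ./ 1) * matrix σ (cell i 0F) (cell i 0F) ≡ ½
  half = begin
    (ℤ.+ 1 ℚ./ 1) * matrix σ (cell i 0F) (cell i 0F)
      ≡⟨ cong ((ℤ.+ 1 ℚ./ 1) *_) (trans (matrix-cell σ (cell i 0F) i 0F)
          (column-cell i (σ i) 0F i 0F)) ⟩
    (ℤ.+ 1 ℚ./ 1) * (½ * (I i i + 1ℚ * (I i (σ i) * 1ℚ)))
      ≡⟨ cong₂ (λ x y → (ℤ.+ 1 ℚ./ 1) * (½ * (x + 1ℚ * (y * 1ℚ)))) (I-diag i) (I-off (σi≢i ∘ sym)) ⟩
    ½ ∎

  minimal : ∀ k → 0 ℕ.< k → IsIntegral ((ℤ.+ k ℚ./ 1) • matrix σ) → 2 ℕ.≤ k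
  minimal (suc zero) _ integral =
    let z , eq = integral (cell i 0F) (cell i 0F) in contradiction (trans (sym half) eq) (½-not-integral z)
  minimal (suc (suc k)) _ _ = ℕ.s≤s (ℕ.s≤s ℕ.z≤n)

matrix-isFactor : ∀ π → Splits (π ⟨$⟩ʳ_) → IsFactor (matrix (π ⟨$⟩ʳ_))
matrix-isFactor π ((p , q , k , separates) , i , moved) = record
  { decomposable      = matrix-decomposable (arrange p q) k {π ⟨$⟩ʳ_} separates
  ; regularOrthogonal = matrix-regularOrthogonal π
  ; level≤2           = 2 , ℕ.≤-refl , matrix-level {π ⟨$⟩ʳ_} {i} moved
  }

-- matrix π · matrix (rest π) is R₁₀.
rest : Permutation′ 5 → Permutation′ 5
rest π = rotation ∘ₚ Perm.flip π

-- Each π fixes a point. The product of π⁻¹ with the 5-cycle has orbits of sizes 1 and 4 or 2 and 3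
-- for a transposition, and 3, 1, 1 or 1, 2, 2 for the double transpositions.
middle-splits : ∀ m i → Splits (middle m i ⟨$⟩ʳ_) × Splits (rest (middle m i) ⟨$⟩ʳ_)
middle-splits = toWitness {a? = all? λ m → all? λ i → splits? (middle m i ⟨$⟩ʳ_) ×-dec splits?
    (rest (middle m i) ⟨$⟩ʳ_)} tt

-- With two factors the only proper prefix is `matrix π`. Coherence for π handles the block B, and
-- uniformity handles all border columns at once.
coherent⇒reducible : ∀ {B A e} → B ≐ patterned A e → WellFormed A e → ∀ π →
  Splits (π ⟨$⟩ʳ_) → Splits (rest π ⟨$⟩ʳ_) → Coherent A (π ⟨$⟩ʳ_) → Reducible R₁₀ B
coherent⇒reducible {B} {A} {e} B≐ wf π split split′ coherent = record
  { factors   = S ∷ S′ ∷ []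
  ; isFactor  = matrix-isFactor π split ∷ matrix-isFactor (rest π) split′ ∷ []
  ; product   = ≐-trans R₁₀≐matrix (≐-sym (≐-trans (·-cong (≐-refl {A = S}) (·-identityʳ S′))
      (≐-trans (matrix-· (π ⟨$⟩ʳ_) (rest π ⟨$⟩ʳ_)) (matrix-cong {τ = next} λ _ → Perm.inverseʳ π))))
  ; adjacency = adjacency
  }
  where
  S  = matrix (π ⟨$⟩ʳ_)
  S′ = matrix (rest π ⟨$⟩ʳ_)

  adjacency : ∀ i → 1 ℕ.≤ i → i ℕ.< 2 → ∀ m (V : Matrix 10 m) (W : Matrix m m) →
      (∀ j → 𝓥 R₁₀ ((V ᵀ) j)) →
    let A = ⟦ B , V ⨾ V ᵀ , W ⟧ ; Q = ∏ (List.map (extend m) (List.take i (S ∷ S′ ∷ []))) in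
    IsAdjacency A → IsAdjacency (Q ᵀ · A · Q)
  adjacency (suc (suc _)) _ (ℕ.s≤s (ℕ.s≤s ()))
  adjacency (suc zero) _ _ m V W inV adj =
    isAdjacency-resp (congruence-cong (≐-sym (·-identityʳ (extend m S)))
        (≐-refl {A = ⟦ B , V ⨾ V ᵀ , W ⟧}))
      (bordered-adjacency S B V W
        (isAdjacency-resp (congruence-cong (≐-refl {A = S}) (≐-sym B≐))
            (coherent⇒adjacency wf coherent))
        (λ i j → let u , v≗u , uniform = 𝓥⇒uniform (inV j) in
           subst Is01 (·ᵛ-cong {A = S ᵀ} {A′ = S ᵀ} (λ _ _ → refl) (λ r → sym (v≗u r)) i)
               (uniform⇒01 u uniform (π ⟨$⟩ʳ_) i))
        adj)

-- Classification of the patterns that occur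

patterned-cong : ∀ {A A′ e e′} → (∀ i j → A i j ≡ A′ i j) → (∀ i j → e i j ≡ e′ i j) →
    patterned A e ≐ patterned A′ e′
patterned-cong A≗ e≗ r c =
  cong₂ (λ s f → val (entryBit s f (side r) (side c))) (A≗ (block r) (block c)) (e≗ (block r) (block c))

𝓑-resp : ∀ {n} {R B B′ : Matrix n n} → B ≐ B′ → 𝓑 R B → 𝓑 R B′
𝓑-resp {R = R} B≐B′ (adj , adj′) =
  isAdjacency-resp B≐B′ adj , isAdjacency-resp (congruence-cong (≐-refl {A = R}) B≐B′) adj′

coherent-resp : ∀ {A A′ σ} → (∀ i j → A i j ≡ A′ i j) → Coherent A σ → Coherent A′ σ
coherent-resp {σ = σ} A≗ coherent i j = subst (_≡ 1)
  (cong₄ (λ s t u v → count (isFlat s) (isCol t) (isRow u) (isTwist v)) (A≗ i j) (A≗ i (σ j))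
      (A≗ (σ i) j) (A≗ (σ i) (σ j)))
  (coherent i j)

IsDiagonal : Shape → Set
IsDiagonal s = s ≡ flat ⊎ s ≡ twist

private
  isDiagonal? : ∀ s → Dec (IsDiagonal s)
  isDiagonal? s = s ≟ˢ flat ⊎-dec s ≟ˢ twist

  -- At a diagonal position the column and row indicators coincide, so together they contribute 0 or
  -- 2 and must vanish. Then exactly one of "s is flat" and "t is twisted" holds, which makes s and
  -- t equal.
  diagonal-step : ∀ s → IsDiagonal s → ∀ t → IsDiagonal t → ∀ u → Compatible s u (swap u) t → t ≡ s ×
      u ≢ col
  diagonal-step = toWitness {a? = all-Shape? λ s → isDiagonal? s →-dec all-Shape? λ t →
      isDiagonal? t →-dec
    all-Shape? λ u → compatible? s u (swap u) t →-dec (t ≟ˢ s ×-dec ¬? (u ≟ˢ col))} tt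

module _ {A e} (wf : WellFormed A e) (coherent : Coherent A next) where
  open WellFormed wf

  private
    step : ∀ i → A (next i) (next i) ≡ A i i × A i (next i) ≢ col
    step i = diagonal-step (A i i) (pattern-diagonal i) (A (next i) (next i))
        (pattern-diagonal (next i)) (A i (next i))
      (subst (λ s → Compatible (A i i) (A i (next i)) s (A (next i) (next i)))
          (pattern-symmetric i (next i)) (coherent i i))

    d : Shape
    d = A 0F 0F

    a b : Vector Shape 5
    a = tuple (A 0F 1F) (A 1F 2F) (A 2F 3F) (A 3F 4F) (A 4F 0F)
    b = tuple (A 0F 2F) (A 1F 3F) (A 2F 4F) (A 3F 0F) (A 4F 1F)

    diag : ∀ i → A i i ≡ d
    diag = next-induction (λ i → A i i ≡ d) (λ i eq → trans (proj₁ (step i)) eq) {0F} refl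

    A≗cyclic : ∀ i j → A i j ≡ cyclic d a b i j
    A≗cyclic 0F 0F = diag 0F
    A≗cyclic 1F 1F = diag 1F
    A≗cyclic 2F 2F = diag 2F
    A≗cyclic 3F 3F = diag 3F
    A≗cyclic 4F 4F = diag 4F
    A≗cyclic 0F 1F = refl
    A≗cyclic 1F 2F = refl
    A≗cyclic 2F 3F = refl
    A≗cyclic 3F 4F = refl
    A≗cyclic 4F 0F = refl
    A≗cyclic 0F 2F = refl
    A≗cyclic 1F 3F = refl
    A≗cyclic 2F 4F = refl
    A≗cyclic 3F 0F = refl
    A≗cyclic 4F 1F = refl
    A≗cyclic 0F 3F = pattern-symmetric 3F 0F
    A≗cyclic 1F 4F = pattern-symmetric 4F 1F
    A≗cyclic 2F 0F = pattern-symmetric 0F 2F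
    A≗cyclic 3F 1F = pattern-symmetric 1F 3F
    A≗cyclic 4F 2F = pattern-symmetric 2F 4F
    A≗cyclic 0F 4F = pattern-symmetric 4F 0F
    A≗cyclic 1F 0F = pattern-symmetric 0F 1F
    A≗cyclic 2F 1F = pattern-symmetric 1F 2F
    A≗cyclic 3F 2F = pattern-symmetric 2F 3F
    A≗cyclic 4F 3F = pattern-symmetric 3F 4F

    outcome : Classified d → Outcome d a b
    outcome classified = classified
      -- Coherence enters at the positions (i , i + 1) and (i , i + 2), in the order of the pruned
      -- search; the diagonal positions have been exploited in `step`.
      (a 0F) (proj₂ (step 0F)) (a 1F) (proj₂ (step 1F)) (b 0F) (cc 0F 1F)
      (a 2F) (proj₂ (step 2F)) (b 1F) (cc 1F 2F)
      (a 3F) (proj₂ (step 3F)) (b 2F) (cc 2F 3F)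
      (a 4F) (proj₂ (step 4F)) (b 3F) (cc 3F 4F) (cc 0F 2F) (cc 2F 4F)
      (b 4F) (cc 4F 0F) (cc 1F 3F) (cc 3F 0F) (cc 4F 1F)
      where
      cc : Coherent (cyclic d a b) next
      cc = coherent-resp {A} {cyclic d a b} A≗cyclic coherent

    classified : ∀ {s} → IsDiagonal s → Classified s
    classified (inj₁ refl) = classified-flat
    classified (inj₂ refl) = classified-twist

  classification : (∃[ k ] ∃[ s ] IsDiagonal s × (∀ i j → A i j ≡ irreducibleShape k s i j)) ⊎
                   (∃[ m ] ∃[ i ] Coherent A (middle m i ⟨$⟩ʳ_))
  classification with outcome (classified (pattern-diagonal 0F))
  ... | inj₁ (k , eq)       = inj₁ (k , d , pattern-diagonal 0F , λ i j → trans (A≗cyclic i j) (eq i j))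
  ... | inj₂ (m , i , good) = inj₂ (m , i , coherent-resp {cyclic d a b} {A}
      (λ k l → sym (A≗cyclic k l)) good)

-- Equivalence with a representative

-- The block I is the complement of the matrix with bits a + b.
representativeFlips : Fin 3 → Flips
representativeFlips k i j = isTwist (irreducibleShape k flat i j)

representative≐ : ∀ k → representative k ≐ patterned (irreducibleShape k flat) (representativeFlips k)
representative≐ = toWitness {a? = all? λ k → equalMatrices? (representative k)
    (patterned (irreducibleShape k flat) (representativeFlips k))} tt

record Symmetric (e : Flips) : Set where
  field
    symmetric : ∀ i j → e j i ≡ e i j
    diagonal  : ∀ i → e i i ≡ false

opaque
  irreducible-wellFormed : ∀ k {e} → Symmetric e → WellFormed (irreducibleShape k flat) e
  irreducible-wellFormed k sym-e = record
    { pattern-symmetric = toWitness {a? = all? λ k → all? λ i → all? λ j →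
        irreducibleShape k flat j i ≟ˢ swap (irreducibleShape k flat i j)} tt k
    ; pattern-diagonal  = λ i → inj₁ (toWitness
        {a? = all? λ k → all? λ i → irreducibleShape k flat i i ≟ˢ flat} tt k i)
    ; flips-symmetric   = Symmetric.symmetric sym-e
    ; flips-diagonal    = Symmetric.diagonal sym-e
    }

  irreducible-coherent : ∀ k → Coherent (irreducibleShape k flat) next
  irreducible-coherent = toWitness {a? = all? λ k → coherent? (irreducibleShape k flat) next} tt

representativeFlips-symmetric : ∀ k → Symmetric (representativeFlips k)
representativeFlips-symmetric k = record
  { symmetric = toWitness {a? = all? λ k → all? λ i → all? λ j →
      representativeFlips k j i Bool.≟ representativeFlips k i j} tt k
  ; diagonal  = toWitness {a? = all? λ k → all? λ i → representativeFlips k i i Bool.≟ false} tt k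
  }

-- The relation `∼` lives on matrices with a proof of membership, so every matrix along a chain of
-- moves must lie in 𝓑 R₁₀. Coherence concerns shapes alone, hence any symmetric choice of flips
-- qualifies.
member : ∀ k {e} → Symmetric e → ∃ (𝓑 R₁₀)
member k {e} sym-e = patterned (irreducibleShape k flat) e , coherent⇒𝓑 (irreducible-wellFormed k sym-e)
    (irreducible-coherent k)

opaque
  representative∈𝓑 : ∀ k → 𝓑 R₁₀ (representative k)
  representative∈𝓑 k = 𝓑-resp {R = R₁₀} (≐-sym (representative≐ k))
      (proj₂ (member k (representativeFlips-symmetric k)))

move : {B B′ : ∃ (𝓑 R₁₀)} → Move (proj₁ B) (proj₁ B′) → B ∼ B′
move m = fwd m ◅ ε

-- Entrywise equal matrices may differ as functions and in their membership proofs; conjugation by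
-- the identity connects them.
≐⇒∼ : {B B′ : ∃ (𝓑 R₁₀)} → proj₁ B ≐ proj₁ B′ → B ∼ B′
≐⇒∼ {B} {B′} B≐B′ = move {B} {B′} (conjugation Perm.id Perm.id (identity R₁₀)
    (≐-sym (≐-trans (identity (proj₁ B)) B≐B′)))
  where
  identity : (A : Matrix 10 10) → I ᵀ · A · I ≐ A
  identity A = ≐-trans (·-identityʳ (I ᵀ · A))
      (≐-trans (·-cong {B = A} (λ i j → I-sym j i) ≐-refl) (·-identityˡ A))

toggle : Fin 5 → Fin 5 → Flips → Flips
toggle i j e k l = if (does (k ≟ i) ∧ does (l ≟ j)) ∨ (does (k ≟ j) ∧ does (l ≟ i)) then not
    (e k l) else e k l

toggle-complements : ∀ i j A e → patterned A (toggle i j e) ≐ complementBlocks i j (patterned A e)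
toggle-complements i j A e r c = lemma
  ((does (block r ≟ i) ∧ does (block c ≟ j)) ∨ (does (block r ≟ j) ∧ does (block c ≟ i)))
  (e (block r) (block c)) (mask (A (block r) (block c)) (side r) (side c))
  where
  lemma : ∀ b f m → val ((if b then not f else f) xor m) ≡
      (if b then 1ℚ - val (f xor m) else val (f xor m))
  lemma = toWitness {a? = all-Bool? λ b → all-Bool? λ f → all-Bool? λ m →
    val ((if b then not f else f) xor m) ℚ.≟ (if b then 1ℚ - val (f xor m) else val (f xor m))} tt

toggle-cases : ∀ i j e k l → (toggle i j e k l ≡ e k l) ⊎ (k ≡ i × l ≡ j) ⊎ (k ≡ j × l ≡ i)
toggle-cases i j e k l with k ≟ i | l ≟ j | k ≟ j | l ≟ i
... | yes p | yes q | _     | _     = inj₂ (inj₁ (p , q))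
... | yes _ | no _  | yes p | yes q = inj₂ (inj₂ (p , q))
... | no _  | _     | yes p | yes q = inj₂ (inj₂ (p , q))
... | yes _ | no _  | yes _ | no _  = inj₁ refl
... | yes _ | no _  | no _  | _     = inj₁ refl
... | no _  | _     | yes _ | no _  = inj₁ refl
... | no _  | _     | no _  | _     = inj₁ refl

toggle-hit : ∀ i j e → toggle i j e i j ≡ not (e i j)
toggle-hit i j e with i ≟ i | j ≟ j
... | yes _ | yes _  = refl
... | yes _ | no j≢j = contradiction refl j≢j
... | no i≢i | _     = contradiction refl i≢i

toggle-symmetric : ∀ {i j e} → i ≢ j → Symmetric e → Symmetric (toggle i j e)
toggle-symmetric {i} {j} {e} i≢j sym-e = record
  { symmetric = λ k l → cong₂ (λ b f → if b then not f else f)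
      (trans (Bool.∨-comm (does (l ≟ i) ∧ does (k ≟ j)) (does (l ≟ j) ∧ does (k ≟ i)))
             (cong₂ _∨_ (Bool.∧-comm (does (l ≟ j)) (does (k ≟ i)))
                 (Bool.∧-comm (does (l ≟ i)) (does (k ≟ j)))))
      (symmetric k l)
  ; diagonal  = λ k → diagonal′ k (toggle-cases i j e k k)
  }
  where
  open Symmetric sym-e
  diagonal′ : ∀ k → (toggle i j e k k ≡ e k k) ⊎ (k ≡ i × k ≡ j) ⊎ (k ≡ j × k ≡ i) → toggle i j e k k ≡
      false
  diagonal′ k (inj₁ eq) = trans eq (diagonal k)
  diagonal′ k (inj₂ (inj₁ (p , q))) = contradiction (trans (sym p) q) i≢j
  diagonal′ k (inj₂ (inj₂ (p , q))) = contradiction (trans (sym q) p) i≢j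

module _ (k : Fin 3) where
  private
    target = representativeFlips k

  record Aligned (ps : List (Fin 5 × Fin 5)) {e} (sym-e : Symmetric e) : Set where
    field
      {flips}    : Flips
      symmetric  : Symmetric flips
      equivalent : member k sym-e ∼ member k symmetric
      agree      : All (λ (i , j) → flips i j ≡ target i j) ps

  -- A toggle at (i , j) changes only (i , j) and (j , i). If one of these already agreed with the
  -- target, symmetry would make both agree, so a needed toggle never spoils earlier agreement.
  -- Diagonal flips agree from the start, hence a toggled pair is off the diagonal.
  align : ∀ ps {e} (sym-e : Symmetric e) → Aligned ps sym-e
  align [] sym-e = record { symmetric = sym-e ; equivalent = ε ; agree = [] }
  align ((i , j) ∷ ps) {e} sym-e = result (flips i j Bool.≟ target i j)
    where
    open Aligned (align ps sym-e)
    result : Dec (flips i j ≡ target i j) → Aligned ((i , j) ∷ ps) sym-e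
    result (yes eq) = record { symmetric = symmetric ; equivalent = equivalent ; agree = eq ∷ agree }
    result (no differ) = record
      { symmetric  = toggled
      ; equivalent = equivalent ◅◅ move {member k symmetric} {member k toggled}
                       (blockComplement i j i≢j (toggle-complements i j
                           (irreducibleShape k flat) flips))
      ; agree      = trans (toggle-hit i j flips) (sym (Bool.¬-not (differ ∘ sym))) ∷ All.map
          (λ {p} → keep (proj₁ p) (proj₂ p)) agree
      }
      where
      i≢j : i ≢ j
      i≢j refl = differ (trans (Symmetric.diagonal symmetric i)
          (sym (Symmetric.diagonal (representativeFlips-symmetric k) i)))
      toggled : Symmetric (toggle i j flips)
      toggled = toggle-symmetric i≢j symmetric
      keep : ∀ u v → flips u v ≡ target u v → toggle i j flips u v ≡ target u v
      keep u v eq with toggle-cases i j flips u v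
      ... | inj₁ same = trans same eq
      ... | inj₂ (inj₁ (refl , refl)) = contradiction eq differ
      ... | inj₂ (inj₂ (refl , refl)) = contradiction
        (trans (Symmetric.symmetric symmetric u v)
            (trans eq (Symmetric.symmetric (representativeFlips-symmetric k) v u))) differ

  member∼representative : ∀ {e} (sym-e : Symmetric e) → member k sym-e ∼
      (representative k , representative∈𝓑 k)
  member∼representative sym-e = equivalent ◅◅ ≐⇒∼ {member k symmetric}
      {representative k , representative∈𝓑 k}
    (≐-trans (patterned-cong {irreducibleShape k flat} (λ _ _ → refl) λ i j →
        All.lookup agree (∈-cartesianProduct⁺ (∈-allFin i) (∈-allFin j)))
      (≐-sym (representative≐ k)))
    where open Aligned (align (List.cartesianProduct (List.allFin 5) (List.allFin 5)) sym-e)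

private
  I-split : ∀ (r c : Fin 10) → I r c ≡ val (does (block r ≟ block c) ∧ does (side r ≟ side c))
  I-split = toWitness {a? = all? λ r → all? λ c → I r c ℚ.≟ val
      (does (block r ≟ block c) ∧ does (side r ≟ side c))} tt

  twist-diagonal : ∀ k i → irreducibleShape k twist i i ≡ twist
  twist-diagonal = toWitness {a? = all? λ k → all? λ i → irreducibleShape k twist i i ≟ˢ twist} tt

  flat-diagonal : ∀ k i → irreducibleShape k flat i i ≡ flat
  flat-diagonal = toWitness {a? = all? λ k → all? λ i → irreducibleShape k flat i i ≟ˢ flat} tt

  off-diagonal : ∀ k i j → i ≢ j → irreducibleShape k twist i j ≡ irreducibleShape k flat i j
  off-diagonal = toWitness {a? = all? λ k → all? λ i → all? λ j → ¬? (i ≟ j) →-dec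
      irreducibleShape k twist i j ≟ˢ irreducibleShape k flat i j} tt

  twist-complement : ∀ a b → val false ≡ 1ℚ - val (does (a ≟ b)) - val (bit a xor bit b)
  twist-complement = toWitness {a? = all? λ a → all? λ b → val false ℚ.≟ 1ℚ - val (does (a ≟ b)) - val
      (bit a xor bit b)} tt

  flip-complement : ∀ f m → val (not f xor m) ≡ 1ℚ - 0ℚ - val (f xor m)
  flip-complement = toWitness {a? = all-Bool? λ f → all-Bool? λ m → val (not f xor m) ℚ.≟ 1ℚ - 0ℚ - val
      (f xor m)} tt

complementFlips : Flips → Flips
complementFlips e i j = if does (i ≟ j) then false else not (e i j)

complementFlips-symmetric : ∀ {e} → Symmetric e → Symmetric (complementFlips e)
complementFlips-symmetric {e} sym-e = record { symmetric = symm ; diagonal = diag }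
  where
  open Symmetric sym-e
  symm : ∀ i j → complementFlips e j i ≡ complementFlips e i j
  symm i j with i ≟ j | j ≟ i
  ... | yes _ | yes _ = refl
  ... | no _  | no _  = cong not (symmetric i j)
  ... | yes p | no ¬q = contradiction (sym p) ¬q
  ... | no ¬p | yes q = contradiction (sym q) ¬p
  diag : ∀ i → complementFlips e i i ≡ false
  diag i with i ≟ i
  ... | yes _ = refl
  ... | no i≢i = contradiction refl i≢i

-- On the diagonal, subtracting I as well turns the exchange matrix into the zero block, so twisted
-- becomes flat. Elsewhere complementation keeps the shape and negates the flip. This removes the
-- twisted diagonals.
complement-pattern : ∀ k {e} → Symmetric e →
  patterned (irreducibleShape k flat) (complementFlips e) ≐ J ⊝ I ⊝ patterned
      (irreducibleShape k twist) e
complement-pattern k {e} sym-e r c = trans (lemma (block r) (block c) (side r) (side c))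
  (cong (λ x → 1ℚ - x - patterned (irreducibleShape k twist) e r c) (sym (I-split r c)))
  where
  lemma : ∀ i j a b → val (entryBit (irreducibleShape k flat i j) (complementFlips e i j) a b) ≡
    1ℚ - val (does (i ≟ j) ∧ does (a ≟ b)) - val (entryBit (irreducibleShape k twist i j) (e i j) a b)
  lemma i j a b with i ≟ j
  ... | yes refl = begin
    val (entryBit (irreducibleShape k flat i i) false a b) ≡⟨ cong (λ s → val (entryBit s false a b))
        (flat-diagonal k i) ⟩
    val false ≡⟨ twist-complement a b ⟩
    1ℚ - val (does (a ≟ b)) - val (entryBit twist false a b)
      ≡⟨ cong₂ (λ s f → 1ℚ - val (does (a ≟ b)) - val (entryBit s f a b)) (twist-diagonal k i)
          (Symmetric.diagonal sym-e i) ⟨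
    1ℚ - val (does (a ≟ b)) - val (entryBit (irreducibleShape k twist i i) (e i i) a b) ∎
  ... | no i≢j = begin
    val (entryBit (irreducibleShape k flat i j) (not (e i j)) a b)
      ≡⟨ flip-complement (e i j) (mask (irreducibleShape k flat i j) a b) ⟩
    1ℚ - 0ℚ - val (entryBit (irreducibleShape k flat i j) (e i j) a b)
      ≡⟨ cong (λ s → 1ℚ - 0ℚ - val (entryBit s (e i j) a b)) (off-diagonal k i j i≢j) ⟨
    1ℚ - 0ℚ - val (entryBit (irreducibleShape k twist i j) (e i j) a b) ∎

irreducible⇒equivalent : (B : ∃ (𝓑 R₁₀)) → Irreducible R₁₀ (proj₁ B) →
                         ∃[ k ] B ∼ (representative k , representative∈𝓑 k)
irreducible⇒equivalent B@(M , M∈𝓑) irreducible = result (classification wellFormed coherent)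
  where
  open PatternOf (𝓑⇒pattern M∈𝓑)
  symmetric-flips : Symmetric flips
  symmetric-flips = record { symmetric = WellFormed.flips-symmetric wellFormed ; diagonal =
      WellFormed.flips-diagonal wellFormed }

  result : _ → ∃[ k ] B ∼ (representative k , representative∈𝓑 k)
  result (inj₂ (m , i , good)) = contradiction
    (coherent⇒reducible realises wellFormed (middle m i) (proj₁ (middle-splits m i))
        (proj₂ (middle-splits m i)) good) irreducible
  result (inj₁ (k , .flat , inj₁ refl , eq)) = k , (≐⇒∼ {B} {member k symmetric-flips}
    (≐-trans realises (patterned-cong {e = flips} eq λ _ _ → refl)) ◅◅ member∼representative k
        symmetric-flips)
  result (inj₁ (k , .twist , inj₂ refl , eq)) = k , (move {B} {member k complemented}
    (complement (≐-trans (complement-pattern k symmetric-flips)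
      λ r c → cong (λ x → 1ℚ - I r c - x) (sym (trans (realises r c)
          (patterned-cong {e = flips} eq (λ _ _ → refl) r c))))) ◅◅ member∼representative k
              complemented)
    where complemented = complementFlips-symmetric symmetric-flips

-- Irreducibility of the representatives

-- Singletons show that every entry is 0 or 1, and pairs forbid two ones.
atMostOne : (s : Vector ℚ 5) → (∀ (u : Fin 5 → Bool) → Is01 (sum λ i → val (u i) * s i)) →
            (∀ i → s i ≡ 0ℚ) ⊎ (∃[ α ] ∀ i → s i ≡ I i α)
atMostOne s sums = result (any? λ i → s i ℚ.≟ 1ℚ)
  where
  s01 : ∀ i → Is01 (s i)
  s01 i = subst Is01 (sum-select i s) (sums λ j → does (i ≟ j))

  pair : ∀ {i j} → i ≢ j → Is01 (s i + s j)
  pair {i} {j} i≢j = subst Is01 (begin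
    sum (λ k → val (does (i ≟ k) ∨ does (j ≟ k)) * s k) ≡⟨ sum-cong-≗
        (λ k → trans (cong (_* s k) (or k)) (ℚ.*-distribʳ-+ (s k) (I i k) (I j k))) ⟩
    sum (λ k → I i k * s k + I j k * s k) ≡⟨ ∑-distrib-+ (λ k → I i k * s k) (λ k → I j k * s k) ⟩
    sum (λ k → I i k * s k) + sum (λ k → I j k * s k) ≡⟨ cong₂ _+_ (sum-select i s) (sum-select j s) ⟩
    s i + s j ∎) (sums λ k → does (i ≟ k) ∨ does (j ≟ k))
    where
    or : ∀ k → val (does (i ≟ k) ∨ does (j ≟ k)) ≡ I i k + I j k
    or k with i ≟ k | j ≟ k
    ... | yes p | yes q = contradiction (trans p (sym q)) i≢j
    ... | yes _ | no _  = refl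
    ... | no _  | yes _ = refl
    ... | no _  | no _  = refl

  result : Dec (∃[ i ] s i ≡ 1ℚ) → (∀ i → s i ≡ 0ℚ) ⊎ (∃[ α ] ∀ i → s i ≡ I i α)
  result (no none) = inj₁ λ i → Sum.[ id , (λ eq → contradiction (i , eq) none) ] (s01 i)
  result (yes (α , sα≡1)) = inj₂ (α , λ i → at i (i ≟ α))
    where
    at : ∀ i → Dec (i ≡ α) → s i ≡ I i α
    at i (yes refl) = trans sα≡1 (sym (I-diag i))
    at i (no i≢α) = trans (zero′ (s01 i) (subst (λ x → Is01 (s i + x)) sα≡1 (pair i≢α)))
        (sym (I-off i≢α))
      where
      zero′ : ∀ {x} → Is01 x → Is01 (x + 1ℚ) → x ≡ 0ℚ
      zero′ (inj₁ eq) _ = eq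
      zero′ (inj₂ refl) (inj₁ ())
      zero′ (inj₂ refl) (inj₂ ())

-- The vectors of 𝓥 R₁₀ are the 01-vectors that are constant on every block and
-- those that are non-constant on every block.  Pairing x with the former shows
-- that at most one block sum of x is nonzero, pairing with the latter that at
-- most one difference is; the norm forces both to occur.
module _ (x : Vector ℚ 10) (pairing : ∀ u → Uniform u → Is01 (sum λ r → x r * val (u r)))
         (norm : sum (λ r → x r * x r) ≡ 1ℚ) where
  private
    evenSums : ∀ (u : Fin 5 → Bool) → Is01 (sum λ i → val (u i) * x ⁺ i)
    evenSums u = subst Is01 (trans (sum-combine {5} λ r → x r * val (u (block r))) (sum-cong-≗ step))
      (pairing (u ∘ block) λ i j → trans (zero-parity i) (sym (zero-parity j)))
      where
      zero-parity : ∀ i → parity (u ∘ block) i ≡ false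
      zero-parity i = trans (cong₂ (λ k l → u k xor u l) (block-cell i 0F) (block-cell i 1F))
          (Bool.xor-same (u i))
      step : ∀ i → x (cell i 0F) * val (u (block (cell i 0F))) + x (cell i 1F) * val
          (u (block (cell i 1F))) ≡ val (u i) * x ⁺ i
      step i = trans (cong₂ (λ k l → x (cell i 0F) * val (u k) + x (cell i 1F) * val (u l))
          (block-cell i 0F) (block-cell i 1F))
        (solve 3 (λ p q v → p :* v :+ q :* v := v :* (p :+ q)) refl (x (cell i 0F)) (x (cell i 1F))
            (val (u i)))

    base : ℚ
    base = sum {5} λ i → x (cell i 1F)

    -- The test vector picks the first cell of each block where u holds and the second cell
    -- elsewhere; `base` is the pairing when the second cell is picked everywhere.
    oddSums : ∀ (u : Fin 5 → Bool) → Is01 (base + sum λ i → val (u i) * x ⁻ i)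
    oddSums u = subst Is01 (trans (sum-combine {5} λ r → x r * val (w r)) (trans (sum-cong-≗ step)
        (∑-distrib-+ (λ i → x (cell i 1F)) (λ i → val (u i) * x ⁻ i))))
      (pairing w λ i j → trans (one-parity i) (sym (one-parity j)))
      where
      w : Fin 10 → Bool
      w r = u (block r) xor bit (side r)
      w-cell : ∀ i a → w (cell i a) ≡ u i xor bit a
      w-cell i a = cong₂ (λ k b → u k xor bit b) (block-cell i a) (side-cell i a)
      one-parity : ∀ i → parity w i ≡ true
      one-parity i = trans (cong₂ _xor_ (w-cell i 0F) (w-cell i 1F)) (lemma (u i))
        where
        lemma : ∀ b → (b xor false) xor (b xor true) ≡ true
        lemma false = refl
        lemma true  = refl
      step : ∀ i → x (cell i 0F) * val (w (cell i 0F)) + x (cell i 1F) * val (w (cell i 1F)) ≡ x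
          (cell i 1F) + val (u i) * x ⁻ i
      step i = trans (cong₂ (λ p q → x (cell i 0F) * val p + x (cell i 1F) * val q) (w-cell i 0F)
          (w-cell i 1F))
                     (lemma (u i) (x (cell i 0F)) (x (cell i 1F)))
        where
        lemma : ∀ b p q → p * val (b xor false) + q * val (b xor true) ≡ q + val b * (p - q)
        lemma false = solve 2 (λ p q → p :* con 0ℚ :+ q :* con 1ℚ := q :+ con 0ℚ :* (p :- q)) refl
        lemma true  = solve 2 (λ p q → p :* con 1ℚ :+ q :* con 0ℚ := q :+ con 1ℚ :* (p :- q)) refl

    base01 : Is01 base
    base01 = subst Is01 (trans (cong (base +_) (sum-zero λ i → ℚ.*-zeroˡ (x ⁻ i))) (ℚ.+-identityʳ base))
        (oddSums λ _ → false)

    -- If `base` is 0, all subset sums of the differences are 0 or 1. If `base` is 1, they are 0 or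
    -- -1, and the same argument applies to the negated differences. This is the origin of the sign
    -- of the column.
    differences : (∀ i → x ⁻ i ≡ 0ℚ) ⊎ (∃[ β ] ∃[ b ] ∀ i → x ⁻ i ≡ sgn b * I i β)
    differences = split base01
      where
      signed : (Fin 5 → Bool) → ℚ
      signed u = sum λ i → val (u i) * x ⁻ i

      negated : ∀ i → x ⁻ i ≡ - 1ℚ * (- 1ℚ * x ⁻ i)
      negated i = solve 1 (λ y → y := con (- 1ℚ) :* (con (- 1ℚ) :* y)) refl (x ⁻ i)

      scaled : ∀ u → sum (λ i → val (u i) * (- 1ℚ * x ⁻ i)) ≡ - 1ℚ * signed u
      scaled u = trans (sum-cong-≗ λ i → solve 2
          (λ v y → v :* (con (- 1ℚ) :* y) := con (- 1ℚ) :* (v :* y)) refl (val (u i)) (x ⁻ i))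
                       (sym (*-distribˡ-sum (- 1ℚ) λ i → val (u i) * x ⁻ i))

      flipped : ∀ y → Is01 (1ℚ + y) → Is01 (- 1ℚ * y)
      flipped y (inj₁ eq) = inj₂ (trans (solve 1
          (λ y → con (- 1ℚ) :* y := con 1ℚ :- (con 1ℚ :+ y)) refl y) (cong (λ z → 1ℚ - z) eq))
      flipped y (inj₂ eq) = inj₁ (trans (solve 1
          (λ y → con (- 1ℚ) :* y := con 1ℚ :- (con 1ℚ :+ y)) refl y) (cong (λ z → 1ℚ - z) eq))

      split : Is01 base → (∀ i → x ⁻ i ≡ 0ℚ) ⊎ (∃[ β ] ∃[ b ] ∀ i → x ⁻ i ≡ sgn b * I i β)
      split (inj₁ base≡0) = Sum.map id (λ (β , eq) → β , 0F , λ i → trans (eq i)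
          (sym (ℚ.*-identityˡ (I i β))))
        (atMostOne (x ⁻_) λ u → subst Is01 (trans (cong (_+ signed u) base≡0)
            (ℚ.+-identityˡ (signed u))) (oddSums u))
      split (inj₂ base≡1) = Sum.map
        (λ eq i → trans (negated i) (cong (λ z → - 1ℚ * z) (eq i)))
        (λ (β , eq) → β , 1F , λ i → trans (negated i) (cong (λ z → - 1ℚ * z) (eq i)))
        (atMostOne (λ i → - 1ℚ * x ⁻ i) λ u → subst Is01 (sym (scaled u))
          (flipped (signed u) (subst (λ y → Is01 (y + signed u)) base≡1 (oddSums u))))

    -- Parseval for the basis 1ᵢ, δᵢ. A part with a single entry 1 or -1 contributes ½ and a
    -- vanishing part contributes 0.
    norm-split : sum (λ i → ½ * (x ⁺ i * x ⁺ i)) + sum (λ i → ½ * (x ⁻ i * x ⁻ i)) ≡ 1ℚ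
    norm-split = begin
      sum (λ i → ½ * (x ⁺ i * x ⁺ i)) + sum (λ i → ½ * (x ⁻ i * x ⁻ i))
        ≡⟨ ∑-distrib-+ (λ i → ½ * (x ⁺ i * x ⁺ i)) (λ i → ½ * (x ⁻ i * x ⁻ i)) ⟨
      sum (λ i → ½ * (x ⁺ i * x ⁺ i) + ½ * (x ⁻ i * x ⁻ i))
        ≡⟨ sum-cong-≗ (λ i → solve 2 (λ p q → con ½ :* ((p :+ q) :* (p :+ q)) :+ con ½ :*
            ((p :- q) :* (p :- q)) := p :* p :+ q :* q) refl (x (cell i 0F)) (x (cell i 1F))) ⟩
      sum {5} (λ i → x (cell i 0F) * x (cell i 0F) + x (cell i 1F) * x (cell i 1F))
        ≡⟨ sum-combine {5} (λ r → x r * x r) ⟨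
      sum (λ r → x r * x r) ≡⟨ norm ⟩
      1ℚ ∎

    zero-energy : (f : Vector ℚ 5) → (∀ i → f i ≡ 0ℚ) → sum (λ i → ½ * (f i * f i)) ≡ 0ℚ
    zero-energy f f≗0 = sum-zero λ i → cong (λ y → ½ * (y * y)) (f≗0 i)

    unit-energy : (f : Vector ℚ 5) → ∀ b β → (∀ i → f i ≡ sgn b * I i β) → sum (λ i → ½ * (f i * f i)) ≡
        ½
    unit-energy f b β f≗ = trans (sum-cong-≗ λ i → trans (cong (λ y → ½ * (y * y)) (f≗ i))
        (squares b i β))
                                 (sum-select β (λ _ → ½))
      where
      squares : ∀ b (i β : Fin 5) → ½ * ((sgn b * I i β) * (sgn b * I i β)) ≡ I β i * ½
      squares = toWitness {a? = all? λ b → all? λ i → all? λ β → ½ *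
          ((sgn b * I i β) * (sgn b * I i β)) ℚ.≟ I β i * ½} tt

  opaque
    isColumn : ∃[ α ] ∃[ β ] ∃[ b ] ∀ r → x r ≡ column α β b r
    isColumn = assemble (atMostOne (x ⁺_) evenSums) differences
      where
      halves : ∀ i a → x (cell i a) ≡ ½ * (x ⁺ i + x ⁻ i * sgn a)
      halves i 0F = solve 2 (λ p q → p := con ½ :* ((p :+ q) :+ (p :- q) :* con 1ℚ)) refl
          (x (cell i 0F)) (x (cell i 1F))
      halves i 1F = solve 2 (λ p q → q := con ½ :* ((p :+ q) :+ (p :- q) :* con (- 1ℚ))) refl
          (x (cell i 0F)) (x (cell i 1F))

      assemble : (∀ i → x ⁺ i ≡ 0ℚ) ⊎ (∃[ α ] ∀ i → x ⁺ i ≡ I i α) →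
                 (∀ i → x ⁻ i ≡ 0ℚ) ⊎ (∃[ β ] ∃[ b ] ∀ i → x ⁻ i ≡ sgn b * I i β) →
                 ∃[ α ] ∃[ β ] ∃[ b ] ∀ r → x r ≡ column α β b r
      assemble (inj₁ s≗0) (inj₁ d≗0) = contradiction
          (trans (sym norm-split) (cong₂ _+_ (zero-energy (x ⁺_) s≗0) (zero-energy (x ⁻_) d≗0))) λ ()
      assemble (inj₁ s≗0) (inj₂ (β , b , d≗)) = contradiction
          (trans (sym norm-split) (cong₂ _+_ (zero-energy (x ⁺_) s≗0) (unit-energy (x ⁻_) b β d≗))) λ ()
      assemble (inj₂ (α , s≗)) (inj₁ d≗0) = contradiction (trans (sym norm-split) (cong₂ _+_
            (unit-energy (x ⁺_) 0F α (λ i → trans (s≗ i) (sym (ℚ.*-identityˡ (I i α)))))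
                (zero-energy (x ⁻_) d≗0))) λ ()
      assemble (inj₂ (α , s≗)) (inj₂ (β , b , d≗)) = α , β , b , cell-elim
          (λ r → x r ≡ column α β b r) λ i a → begin
        x (cell i a)                              ≡⟨ halves i a ⟩
        ½ * (x ⁺ i + x ⁻ i * sgn a)               ≡⟨ cong₂ (λ s d → ½ * (s + d * sgn a)) (s≗ i) (d≗ i) ⟩
        ½ * (I i α + (sgn b * I i β) * sgn a)     ≡⟨ cong (λ y → ½ * (I i α + y))
            (ℚ.*-assoc (sgn b) (I i β) (sgn a)) ⟩
        ½ * (I i α + sgn b * (I i β * sgn a))     ≡⟨ column-cell α β b i a ⟨
        column α β b (cell i a)                   ∎

-- Prefix products and the cyclic overlap of their columns

-- The properties of regular orthogonal factors that are carried along to prefix products.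
record Orthogonal (S : Matrix n n) : Set where
  field
    gram    : S ᵀ · S ≐ I
    rowSums : ∀ r → sum (S r) ≡ 1ℚ

I-orthogonal : Orthogonal (I {n})
I-orthogonal = record
  { gram    = ≐-trans (·-identityʳ (I ᵀ)) λ i j → I-sym j i
  ; rowSums = λ r → trans (sum-cong-≗ λ c → sym (ℚ.*-identityʳ (I r c))) (sum-select r λ _ → 1ℚ)
  }

·-orthogonal : {S R : Matrix n n} → Orthogonal S → Orthogonal R → Orthogonal (S · R)
·-orthogonal {S = S} {R} orthS orthR = record
  { gram    = ≐-trans (·-cong {B = S · R} (ᵀ-· S R) ≐-refl)
      (≐-trans (·-assoc (R ᵀ) (S ᵀ) (S · R))
      (≐-trans (·-cong (≐-refl {A = R ᵀ}) (≐-trans (≐-sym (·-assoc (S ᵀ) S R))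
        (≐-trans (·-cong {B = R} (Orthogonal.gram orthS) ≐-refl) (·-identityˡ R))))
      (Orthogonal.gram orthR)))
  ; rowSums = λ r → begin
      sum (λ c → sum (λ k → S r k * R k c)) ≡⟨ ∑-comm (λ c k → S r k * R k c) ⟩
      sum (λ k → sum (λ c → S r k * R k c)) ≡⟨ sum-cong-≗
          (λ k → trans (sym (*-distribˡ-sum (S r k) (R k)))
                                                 (trans (cong (S r k *_) (Orthogonal.rowSums orthR k))
                                                     (ℚ.*-identityʳ (S r k)))) ⟩
      sum (S r)                             ≡⟨ Orthogonal.rowSums orthS r ⟩
      1ℚ ∎
  }

orthogonal-resp : {S S′ : Matrix n n} → S ≐ S′ → Orthogonal S → Orthogonal S′
orthogonal-resp {S = S} {S′} S≐ orth = record
  { gram    = ≐-trans (≐-sym (·-cong (λ i j → S≐ j i) S≐)) (Orthogonal.gram orth)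
  ; rowSums = λ r → trans (sym (sum-cong-≗ (S≐ r))) (Orthogonal.rowSums orth r)
  }

isFactor⇒orthogonal : {R : Matrix n n} → IsFactor R → Orthogonal R
isFactor⇒orthogonal factor = record { gram = orthogonalˡ ; rowSums = rowSums }
  where open IsRegularOrthogonal (IsFactor.regularOrthogonal factor)

Permuting : Matrix n n → Set
Permuting S = ∀ r → ∃[ c ] ∀ i → S i c ≡ I i r

-- One column per block is enough for the overlap argument: ½ (1ᵢ + δ_(next i)) is nonzero on all
-- four cells of blocks i and `next i`.
Circular : Matrix 10 10 → Set
Circular S = ∀ i → ∃[ c ] ∀ r → S r c ≡ column i (next i) 0F r

nonzero-column : {S : Matrix n n} → Orthogonal S → ∀ c → ∃[ r ] S r c ≢ 0ℚ
nonzero-column {n} {S} orth c = Fin.¬∀⟶∃¬ n (λ r → S r c ≡ 0ℚ) (λ r → S r c ℚ.≟ 0ℚ) λ zero-column →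
  contradiction (trans (sym (sum-zero λ r → trans (cong (_* S r c) (zero-column r))
      (ℚ.*-zeroˡ (S r c))))
                       (trans (Orthogonal.gram orth c c) (I-diag c))) λ ()

column-nonzero : ∀ i a → column i (next i) 0F (cell i a) ≢ 0ℚ × column i (next i) 0F
    (cell (next i) a) ≢ 0ℚ
column-nonzero = toWitness {a? = all? λ i → all? λ a →
  ¬? (column i (next i) 0F (cell i a) ℚ.≟ 0ℚ) ×-dec ¬? (column i (next i) 0F (cell (next i) a) ℚ.≟ 0ℚ)}
      tt

-- The columns of Q overlap in a cycle through all the blocks, so a
-- block-diagonal form of R puts all of them in the same part.
circular⇒¬decomposable : {P Q R : Matrix 10 10} → Permuting P → Orthogonal Q → Circular Q →
                         P ᵀ · Q ≐ R → ¬ Decomposable R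
circular⇒¬decomposable {P} {Q} {R} permuting orthQ circular P·Q≐R (σ , τ , k , 0<k , k<10 , zeros) =
  contradiction (trans (sym g-first) (trans (constant-g (τ ⟨$⟩ʳ 0F))
      (trans (sym (constant-g (τ ⟨$⟩ʳ 9F))) g-last))) λ ()
  where
  f g : Fin 10 → Bool
  -- The two sides of the cut. Since P is a permutation matrix, row r of Q reappears as a row of R;
  -- `f r` is the side of that row and `g j` the side of column j. A nonzero entry of Q forces both
  -- to agree.
  f r = toℕ (σ ⟨$⟩ˡ proj₁ (permuting r)) ℕ.<ᵇ k
  g j = toℕ (τ ⟨$⟩ˡ j) ℕ.<ᵇ k

  row-of-Q : ∀ r j → R (proj₁ (permuting r)) j ≡ Q r j
  row-of-Q r j = trans (sym (P·Q≐R (proj₁ (permuting r)) j))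
    (trans (sum-cong-≗ λ l → cong (_* Q l j) (trans (proj₂ (permuting r) l) (I-sym l r)))
        (sum-select r λ l → Q l j))

  R-zero : ∀ c j → (toℕ (σ ⟨$⟩ˡ c) ℕ.<ᵇ k) ≢ (toℕ (τ ⟨$⟩ˡ j) ℕ.<ᵇ k) → R c j ≡ 0ℚ
  R-zero c j differ = trans (cong₂ R (sym (Perm.inverseʳ σ)) (sym (Perm.inverseʳ τ)))
    (zeros (σ ⟨$⟩ˡ c) (τ ⟨$⟩ˡ j) (apart (toℕ (σ ⟨$⟩ˡ c)) (toℕ (τ ⟨$⟩ˡ j)) differ))
    where
    apart : ∀ x y → (x ℕ.<ᵇ k) ≢ (y ℕ.<ᵇ k) → (x ℕ.< k × k ℕ.≤ y) ⊎ (k ℕ.≤ x × y ℕ.< k)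
    apart x y differ with x ℕ.<? k | y ℕ.<? k
    ... | yes p | yes q = contradiction (trans (true-of p) (sym (true-of q))) differ
      where
      true-of : ∀ {z} → z ℕ.< k → (z ℕ.<ᵇ k) ≡ true
      true-of p = Equivalence.to Bool.T-≡ (ℕ.<⇒<ᵇ p)
    ... | yes p | no ¬q = inj₁ (p , ℕ.≮⇒≥ ¬q)
    ... | no ¬p | yes q = inj₂ (ℕ.≮⇒≥ ¬p , q)
    ... | no ¬p | no ¬q = contradiction (trans (false-of ¬p) (sym (false-of ¬q))) differ
      where
      false-of : ∀ {z} → ¬ z ℕ.< k → (z ℕ.<ᵇ k) ≡ false
      false-of {z} ¬p with z ℕ.<ᵇ k in eq
      ... | false = refl
      ... | true  = contradiction (ℕ.<ᵇ⇒< z k (subst T (sym eq) tt)) ¬p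

  linked : ∀ {r j} → Q r j ≢ 0ℚ → f r ≡ g j
  linked {r} {j} Qrj≢0 = decidable-stable (f r Bool.≟ g j) λ differ →
    Qrj≢0 (trans (sym (row-of-Q r j)) (R-zero (proj₁ (permuting r)) j differ))

  constant-f : ∀ i a → f (cell i a) ≡ f (cell 0F 0F)
  constant-f = next-induction (λ i → ∀ a → f (cell i a) ≡ f (cell 0F 0F)) step {0F} λ a → same 0F a
    where
    toColumn : ∀ i → Fin 10
    toColumn i = proj₁ (circular i)
    here : ∀ i a → f (cell i a) ≡ g (toColumn i)
    here i a = linked λ eq → proj₁ (column-nonzero i a) (trans (sym (proj₂ (circular i) (cell i a))) eq)
    there : ∀ i a → f (cell (next i) a) ≡ g (toColumn i)
    there i a = linked λ eq → proj₂ (column-nonzero i a)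
        (trans (sym (proj₂ (circular i) (cell (next i) a))) eq)
    same : ∀ i a → f (cell i a) ≡ f (cell i 0F)
    same i a = trans (here i a) (sym (here i 0F))
    step : ∀ i → (∀ a → f (cell i a) ≡ f (cell 0F 0F)) → ∀ a → f (cell (next i) a) ≡ f (cell 0F 0F)
    step i eq a = trans (there i a) (trans (sym (here i a)) (eq a))

  constant-g : ∀ j → g j ≡ f (cell 0F 0F)
  constant-g j = let r , Qrj≢0 = nonzero-column orthQ j in
    trans (sym (linked Qrj≢0)) (cell-elim (λ r → f r ≡ f (cell 0F 0F)) constant-f r)

  -- Positions 0 and 9 lie on opposite sides because 0 < k < 10, so a constant `g` is impossible.
  g-first : g (τ ⟨$⟩ʳ 0F) ≡ true
  g-first = trans (cong (λ i → toℕ i ℕ.<ᵇ k) (Perm.inverseˡ τ)) (Equivalence.to Bool.T-≡ (ℕ.<⇒<ᵇ 0<k))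

  g-last : g (τ ⟨$⟩ʳ 9F) ≡ false
  g-last = trans (cong (λ i → toℕ i ℕ.<ᵇ k) (Perm.inverseˡ τ)) (Bool.¬-not λ eq →
    ℕ.<⇒≱ (ℕ.<ᵇ⇒< 9 k (subst T (sym eq) tt)) (ℕ.s≤s⁻¹ k<10))

-- Rigidity of the three patterns

Fits : Pattern → (i p j q : Fin 5) → Set
Fits A i p j q = Compatible (A i j) (A i q) (A p j) (A p q)

private
  fits? : ∀ A i p j q → Dec (Fits A i p j q)
  fits? A i p j q = compatible? (A i j) (A i q) (A p j) (A p q)

  -- A search over all maps of the five indices, given by their values p₀, ..., p₄. Coherence at (i
  -- , j) with i ≤ j involves only the values at i and j, so each condition prunes as soon as both
  -- are chosen.
  rigid : ∀ k → let A = irreducibleShape k flat in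
    ∀ p₀ → Fits A 0F p₀ 0F p₀ →
    ∀ p₁ → Fits A 1F p₁ 1F p₁ → Fits A 0F p₀ 1F p₁ →
    ∀ p₂ → Fits A 2F p₂ 2F p₂ → Fits A 0F p₀ 2F p₂ → Fits A 1F p₁ 2F p₂ →
    ∀ p₃ → Fits A 3F p₃ 3F p₃ → Fits A 0F p₀ 3F p₃ → Fits A 1F p₁ 3F p₃ → Fits A 2F p₂ 3F p₃ →
    ∀ p₄ → Fits A 4F p₄ 4F p₄ → Fits A 0F p₀ 4F p₄ → Fits A 1F p₁ 4F p₄ → Fits A 2F p₂ 4F p₄ →
        Fits A 3F p₃ 4F p₄ →
    (∀ i → tuple p₀ p₁ p₂ p₃ p₄ i ≡ i) ⊎ (∀ i → tuple p₀ p₁ p₂ p₃ p₄ i ≡ next i)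
  rigid = toWitness {a? = all? λ k → let A = irreducibleShape k flat in
    all? λ p₀ → fits? A 0F p₀ 0F p₀ →-dec
    all? λ p₁ → fits? A 1F p₁ 1F p₁ →-dec fits? A 0F p₀ 1F p₁ →-dec
    all? λ p₂ → fits? A 2F p₂ 2F p₂ →-dec fits? A 0F p₀ 2F p₂ →-dec fits? A 1F p₁ 2F p₂ →-dec
    all? λ p₃ → fits? A 3F p₃ 3F p₃ →-dec fits? A 0F p₀ 3F p₃ →-dec fits? A 1F p₁ 3F p₃ →-dec
        fits? A 2F p₂ 3F p₃ →-dec
    all? λ p₄ → fits? A 4F p₄ 4F p₄ →-dec fits? A 0F p₀ 4F p₄ →-dec fits? A 1F p₁ 4F p₄ →-dec
        fits? A 2F p₂ 4F p₄ →-dec fits? A 3F p₃ 4F p₄ →-dec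
    ((all? λ i → tuple p₀ p₁ p₂ p₃ p₄ i ≟ i) ⊎-dec (all? λ i → tuple p₀ p₁ p₂ p₃ p₄ i ≟ next i))} tt

irreducible-rigid : ∀ k {σ} → Coherent (irreducibleShape k flat) σ → (∀ i → σ i ≡ i) ⊎
    (∀ i → σ i ≡ next i)
irreducible-rigid k {σ} co = Sum.map (λ eq i → trans (tabulated i) (eq i))
    (λ eq i → trans (tabulated i) (eq i))
  (rigid k (σ 0F) (co 0F 0F) (σ 1F) (co 1F 1F) (co 0F 1F) (σ 2F) (co 2F 2F) (co 0F 2F) (co 1F 2F)
     (σ 3F) (co 3F 3F) (co 0F 3F) (co 1F 3F) (co 2F 3F) (σ 4F) (co 4F 4F) (co 0F 4F) (co 1F 4F)
         (co 2F 4F) (co 3F 4F))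
  where
  tabulated : ∀ i → σ i ≡ tuple (σ 0F) (σ 1F) (σ 2F) (σ 3F) (σ 4F) i
  tabulated 0F = refl
  tabulated 1F = refl
  tabulated 2F = refl
  tabulated 3F = refl
  tabulated 4F = refl

-- Columns of a prefix product

module _ {S : Matrix 10 10} (orth : Orthogonal S)
         (pairing : ∀ u → Uniform u → ∀ c → Is01 ((S ᵀ ·ᵛ (val ∘ u)) c)) where
  open Orthogonal orth

  private
    label : ∀ c → ∃[ α ] ∃[ β ] ∃[ b ] ∀ r → S r c ≡ column α β b r
    label c = isColumn (λ r → S r c) (λ u uniform → pairing u uniform c) (trans (gram c c) (I-diag c))

    top bottom : Fin 10 → Fin 5
    top c    = proj₁ (label c)
    bottom c = proj₁ (proj₂ (label c))

    sign : Fin 10 → Fin 2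
    sign c = proj₁ (proj₂ (proj₂ (label c)))

    S-column : ∀ c r → S r c ≡ column (top c) (bottom c) (sign c) r
    S-column c = proj₂ (proj₂ (proj₂ (label c)))

    -- The two row sums of block α add up to 2, and a column contributes 1 to them when its `top` is
    -- α and 0 otherwise. Exactly two columns therefore share each `top`.
    top-total : ∀ α → sum (λ c → I α (top c)) ≡ 1ℚ + 1ℚ
    top-total α = begin
      sum (λ c → I α (top c))
        ≡⟨ sum-cong-≗ (λ c → sym (trans (cong₂ _+_ (S-column c (cell α 0F)) (S-column c (cell α 1F)))
                                        (column-⁺ (top c) (bottom c) (sign c) α))) ⟩
      sum (λ c → S (cell α 0F) c + S (cell α 1F) c)
        ≡⟨ ∑-distrib-+ (S (cell α 0F)) (S (cell α 1F)) ⟩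
      sum (S (cell α 0F)) + sum (S (cell α 1F))
        ≡⟨ cong₂ _+_ (rowSums (cell α 0F)) (rowSums (cell α 1F)) ⟩
      1ℚ + 1ℚ ∎

    opaque
      first : ∀ α → ∃[ c ] α ≡ top c
      first α = decidable-stable (any? {P = λ c → α ≡ top c} λ c → α ≟ top c) λ none →
        contradiction (trans (sym (sum-zero λ c → I-off λ eq → none (c , eq))) (top-total α)) λ ()

      second : ∀ α c → α ≡ top c → ∃[ c′ ] c ≢ c′ × α ≡ top c′
      second α c α≡ = decidable-stable (any? {P = λ c′ → c ≢ c′ × α ≡ top c′} λ c′ → ¬? (c ≟ c′) ×-dec
          (α ≟ top c′)) λ none →
        contradiction (trans (sym (trans (sum-cong-≗ (unique none)) (sum-select c λ _ → 1ℚ)))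
            (top-total α)) λ ()
        where
        unique : ¬ (∃[ c′ ] c ≢ c′ × α ≡ top c′) → ∀ c′ → I α (top c′) ≡ I c c′ * 1ℚ
        unique none c′ = trans (same (c ≟ c′)) (sym (ℚ.*-identityʳ (I c c′)))
          where
          same : Dec (c ≡ c′) → I α (top c′) ≡ I c c′
          same (yes refl) = trans (subst (λ j → I α j ≡ 1ℚ) α≡ (I-diag α)) (sym (I-diag c))
          same (no c≢c′)  = trans (I-off λ eq → none (c′ , c≢c′ , eq)) (sym (I-off c≢c′))

    opposite : ∀ b b′ (β β′ : Fin 5) → ½ * (1ℚ + sgn b * (sgn b′ * I β β′)) ≡ 0ℚ → β ≡ β′ ×
        (∀ a → a ≡ b ⊎ a ≡ b′)
    opposite = toWitness {a? = all? λ b → all? λ b′ → all? λ β → all? λ β′ →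
      (½ * (1ℚ + sgn b * (sgn b′ * I β β′)) ℚ.≟ 0ℚ) →-dec
          ((β ≟ β′) ×-dec (all? λ a → (a ≟ b) ⊎-dec (a ≟ b′)))} tt

    opaque
      -- Two columns with the same `top` have inner product ½ from it, and only equal `bottom` with
      -- opposite signs can cancel this.
      partner : ∀ {c c′} → c ≢ c′ → top c ≡ top c′ →
                bottom c ≡ bottom c′ × (∀ a → a ≡ sign c ⊎ a ≡ sign c′)
      partner {c} {c′} c≢c′ top≡ = opposite (sign c) (sign c′) (bottom c) (bottom c′) (begin
        ½ * (1ℚ + sgn (sign c) * (sgn (sign c′) * I (bottom c) (bottom c′)))
          ≡⟨ cong₂ (λ x y → ½ * (x + sgn (sign c) * y))
               (trans (column-⁺ (top c′) (bottom c′) (sign c′) (top c))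
                   (subst (λ i → I (top c) i ≡ 1ℚ) top≡ (I-diag (top c))))
               (column-⁻ (top c′) (bottom c′) (sign c′) (bottom c)) ⟨
        ½ * (column (top c′) (bottom c′) (sign c′) ⁺ top c + sgn (sign c) * column (top c′) (bottom c′)
            (sign c′) ⁻ bottom c)
          ≡⟨ column-dot (top c) (bottom c) (sign c) (column (top c′) (bottom c′) (sign c′)) ⟨
        sum (λ r → column (top c) (bottom c) (sign c) r * column (top c′) (bottom c′) (sign c′) r)
          ≡⟨ sum-cong-≗ (λ r → cong₂ _*_ (S-column c r) (S-column c′ r)) ⟨
        sum (λ r → S r c * S r c′) ≡⟨ trans (gram c c′) (I-off c≢c′) ⟩
        0ℚ ∎)

  -- Up to the order of its columns, S is matrix σ for some σ.
  opaque
    columns : ∀ α → ∃[ β ] ∀ a → ∃[ c ] ∀ r → S r c ≡ column α β a r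
    columns α = bottom c , λ a → choose a (proj₂ pair a)
      where
      c c′ : Fin 10
      c = proj₁ (first α)
      top-c : α ≡ top c
      top-c = proj₂ (first α)
      c′ = proj₁ (second α c top-c)
      c≢c′ : c ≢ c′
      c≢c′ = proj₁ (proj₂ (second α c top-c))
      top-c′ : α ≡ top c′
      top-c′ = proj₂ (proj₂ (second α c top-c))
      pair : bottom c ≡ bottom c′ × (∀ a → a ≡ sign c ⊎ a ≡ sign c′)
      pair = partner {c} {c′} c≢c′ (trans (sym top-c) top-c′)
      choose : ∀ a → a ≡ sign c ⊎ a ≡ sign c′ → ∃[ d ] ∀ r → S r d ≡ column α (bottom c) a r
      choose a (inj₁ eq) = c , λ r → trans (S-column c r)
          (cong₂ (λ i b → column i (bottom c) b r) (sym top-c) (sym eq))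
      choose a (inj₂ eq) = c′ , λ r → trans (S-column c′ r)
        (trans (cong (λ j → column (top c′) j (sign c′) r) (sym (proj₁ pair)))
            (cong₂ (λ i b → column i (bottom c) b r) (sym top-c′) (sym eq)))

  -- Reordering columns merely permutes the entries of the congruence, so the σ read off from
  -- `columns` is coherent for the representative and rigidity applies. For σ = id the columns ½ (1ᵢ
  -- ± δᵢ) are the unit vectors.
  prefix-dichotomy : ∀ k → (∀ c d → Is01 ((S ᵀ · representative k · S) c d)) → Permuting S ⊎ Circular S
  prefix-dichotomy k entries = Sum.map permuting circular (irreducible-rigid k coherent)
    where
    A = irreducibleShape k flat
    β : Bits
    β = pattern-bits A (representativeFlips k)
    σ : Fin 5 → Fin 5
    σ i = proj₁ (columns i)
    position : Fin 5 → Fin 2 → Fin 10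
    position i a = proj₁ (proj₂ (columns i) a)
    at : ∀ i a r → S r (position i a) ≡ column i (σ i) a r
    at i a = proj₂ (proj₂ (columns i) a)

    integral : ∀ i a j b → Is01 (form (realise β) i (σ i) a j (σ j) b)
    integral i a j b = subst Is01
      (trans (congruence-cong (≐-refl {A = S}) (representative≐ k) (position i a) (position j b))
             (congruence-entry S (realise β) i (σ i) a j (σ j) b (at i a) (at j b)))
      (entries (position i a) (position j b))

    shapes : ∀ k i j → onBlock odd (pattern-bits (irreducibleShape k flat) (representativeFlips k)) i j
        ≡ false ×
                       onBlock shapeOf (pattern-bits (irreducibleShape k flat) (representativeFlips k))
                           i j ≡ irreducibleShape k flat i j
    shapes = toWitness {a? = all? λ k → all? λ i → all? λ j →
      (onBlock odd (pattern-bits (irreducibleShape k flat) (representativeFlips k)) i j Bool.≟ false)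
          ×-dec
      (onBlock shapeOf (pattern-bits (irreducibleShape k flat) (representativeFlips k)) i j ≟ˢ
          irreducibleShape k flat i j)} tt

    coherent : Coherent A σ
    coherent = coherent-resp {onBlock shapeOf β} {A} (λ i j → proj₂ (shapes k i j))
      (even⇒coherent β σ integral λ i j → proj₁ (shapes k i j))

    permuting : (∀ i → σ i ≡ i) → Permuting S
    permuting σ≗id = cell-elim (λ r → ∃[ c ] ∀ i → S i c ≡ I i r) λ i a →
      position i a , λ r → trans (at i a r) (trans (cong (λ j → column i j a r) (σ≗id i)) (unit i a r))
      where
      unit : ∀ i a r → column i i a r ≡ I r (cell i a)
      unit = toWitness {a? = all? λ i → all? λ a → all? λ r → column i i a r ℚ.≟ I r (cell i a)} tt

    circular : (∀ i → σ i ≡ next i) → Circular S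
    circular σ≗next i = position i 0F , λ r → trans (at i 0F r)
        (cong (λ j → column i j 0F r) (σ≗next i))

-- Following a factorisation prefix by prefix

∏-∷ʳ : ∀ (Rs : List (Matrix n n)) R → ∏ (Rs ++ R ∷ []) ≐ ∏ Rs · R
∏-∷ʳ []       R = ≐-trans (·-identityʳ R) (≐-sym (·-identityˡ R))
∏-∷ʳ (Q ∷ Rs) R = ≐-trans (·-cong (≐-refl {A = Q}) (∏-∷ʳ Rs R)) (≐-sym (·-assoc Q (∏ Rs) R))

take-length : ∀ {X : Set} (xs ys : List X) → List.take (List.length xs) (xs ++ ys) ≡ xs
take-length []       ys = refl
take-length (x ∷ xs) ys = cong (x ∷_) (take-length xs ys)

border-adjacency : ∀ {n m} {B : Matrix n n} {V : Matrix n m} {W : Matrix m m} →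
  IsAdjacency B → (∀ i j → Is01 (V i j)) → IsAdjacency W → IsAdjacency ⟦ B , V ⨾ V ᵀ , W ⟧
border-adjacency {n} {m} {B} {V} {W} adjB V01 adjW = record
  { symmetric = symm ; entries01 = entries ; zeroDiagonal = diagonal }
  where
  A = ⟦ B , V ⨾ V ᵀ , W ⟧
  symm : A ᵀ ≐ A
  symm i j with view n i | view n j
  ... | left i  | left j  = trans (block₁₁ B V (V ᵀ) W j i)
      (trans (IsAdjacency.symmetric adjB i j) (sym (block₁₁ B V (V ᵀ) W i j)))
  ... | left i  | right j = trans (block₂₁ B V (V ᵀ) W j i) (sym (block₁₂ B V (V ᵀ) W i j))
  ... | right i | left j  = trans (block₁₂ B V (V ᵀ) W j i) (sym (block₂₁ B V (V ᵀ) W i j))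
  ... | right i | right j = trans (block₂₂ B V (V ᵀ) W j i)
      (trans (IsAdjacency.symmetric adjW i j) (sym (block₂₂ B V (V ᵀ) W i j)))
  entries : ∀ i j → Is01 (A i j)
  entries i j with view n i | view n j
  ... | left i  | left j  = subst Is01 (sym (block₁₁ B V (V ᵀ) W i j)) (IsAdjacency.entries01 adjB i j)
  ... | left i  | right j = subst Is01 (sym (block₁₂ B V (V ᵀ) W i j)) (V01 i j)
  ... | right i | left j  = subst Is01 (sym (block₂₁ B V (V ᵀ) W i j)) (V01 j i)
  ... | right i | right j = subst Is01 (sym (block₂₂ B V (V ᵀ) W i j)) (IsAdjacency.entries01 adjW i j)
  diagonal : ∀ i → A i i ≡ 0ℚ
  diagonal i with view n i
  ... | left i  = trans (block₁₁ B V (V ᵀ) W i i) (IsAdjacency.zeroDiagonal adjB i)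
  ... | right i = trans (block₂₂ B V (V ᵀ) W i i) (IsAdjacency.zeroDiagonal adjW i)

O-adjacency : IsAdjacency (O {n} {n})
O-adjacency = record { symmetric = λ _ _ → refl ; entries01 = λ _ _ → inj₁ refl ; zeroDiagonal = λ _ →
    refl }

R₁₀-circular : Circular R₁₀
R₁₀-circular i = cell i 0F , λ r → trans (R₁₀≐matrix r (cell i 0F)) (matrix-cell next r i 0F)

R₁₀-¬permuting : ¬ Permuting R₁₀
R₁₀-¬permuting permuting = no-one 0F (proj₁ (permuting 0F)) (proj₂ (permuting 0F) 0F)
  where
  no-one : ∀ r c → R₁₀ r c ≢ 1ℚ
  no-one = toWitness {a? = all? λ r → all? λ c → ¬? (R₁₀ r c ℚ.≟ 1ℚ)} tt

representative-irreducible : ∀ k → Irreducible R₁₀ (representative k)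
representative-irreducible k reducible = walk [] factors refl isFactor I-orthogonal
    (λ r → r , λ _ → refl)
  where
  open Reducible reducible

  module _ (pre : List (Matrix 10 10)) (R R′ : Matrix 10 10) (post : List (Matrix 10 10))
           (split : factors ≡ (pre ++ R ∷ []) ++ R′ ∷ post)
               (orth : Orthogonal (∏ (pre ++ R ∷ []))) where
    private
      initial = pre ++ R ∷ []
      S = ∏ initial

      positive : 1 ℕ.≤ List.length initial
      positive = subst (1 ℕ.≤_) (sym (List.length-++ pre)) (ℕ.m≤n+m 1 (List.length pre))

      shorter : List.length initial ℕ.< List.length factors
      shorter = subst (λ l → List.length initial ℕ.< List.length l) (sym split)
        (subst (List.length initial ℕ.<_) (sym (List.length-++ initial))
            (ℕ.m<m+n (List.length initial) ℕ.z<s))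

      -- A single border column suffices: its part of the congruence tests S against the vector u,
      -- while the leading block tests S against the representative. The leading block is later read
      -- off with u = 0.
      bordered : (u : Fin 10 → Bool) → Uniform u →
        let V = λ r (_ : Fin 1) → val (u r) in
        IsAdjacency (extend 1 S ᵀ · ⟦ representative k , V ⨾ V ᵀ , O ⟧ · extend 1 S)
      bordered u uniform = isAdjacency-resp
        {A = ∏ (List.map (extend 1) (List.take (List.length initial) factors)) ᵀ ·
            ⟦ representative k , V ⨾ V ᵀ , O ⟧ · ∏ (List.map (extend 1)
                (List.take (List.length initial) factors))}
        {B = extend 1 S ᵀ · ⟦ representative k , V ⨾ V ᵀ , O ⟧ · extend 1 S}
        (congruence-cong Q≐ (≐-refl {A = ⟦ representative k , V ⨾ V ᵀ , O ⟧}))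
        (adjacency (List.length initial) positive shorter 1 V O (λ _ → uniform⇒𝓥 u uniform)
          (border-adjacency {B = representative k} {V} {O} (proj₁ (representative∈𝓑 k))
              (λ i _ → val-01 (u i)) O-adjacency))
        where
        V : Matrix 10 1
        V r _ = val (u r)
        Q≐ : ∏ (List.map (extend 1) (List.take (List.length initial) factors)) ≐ extend 1 S
        Q≐ = subst (λ l → ∏ (List.map (extend 1) l) ≐ extend 1 S)
          (sym (trans (cong (List.take (List.length initial)) split) (take-length initial (R′ ∷ post))))
          (∏-extend 1 initial)

    step : Permuting S ⊎ Circular S
    step = prefix-dichotomy orth
      (λ u uniform c → let V = λ r (_ : Fin 1) → val (u r) in
        subst Is01 (bordered₁₂ S (representative k) V O c 0F)
          (IsAdjacency.entries01 (bordered u uniform) (c ↑ˡ 1) (10 ↑ʳ 0F)))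
      k λ c d → let V = λ (r : Fin 10) (_ : Fin 1) → 0ℚ in
        subst Is01 (bordered₁₁ S (representative k) V O c d)
          (IsAdjacency.entries01 (bordered (λ _ → false) (λ _ _ → refl)) (c ↑ˡ 1) (d ↑ˡ 1))

  -- The invariant is that the product so far is a permutation matrix. The next product either keeps
  -- it or is circular, and then the factor just passed, being a row permutation of a circular
  -- matrix, cannot be decomposable. Keeping the invariant to the end would make R₁₀ a permutation
  -- matrix.
  walk : ∀ pre post → factors ≡ pre ++ post → All IsFactor post → Orthogonal (∏ pre) → Permuting
      (∏ pre) → ⊥
  walk pre [] split _ _ permuting = R₁₀-¬permuting λ r → let c , eq = permuting r in
    c , λ i → trans (R₁₀≐ i c) (eq i)
    where
    R₁₀≐ : R₁₀ ≐ ∏ pre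
    R₁₀≐ = subst (λ l → R₁₀ ≐ ∏ l) (trans split (List.++-identityʳ pre)) product
  walk pre (R ∷ post) split (factor ∷ isFactor) orth permuting = continue post split isFactor
    where
    orth′ : Orthogonal (∏ (pre ++ R ∷ []))
    orth′ = orthogonal-resp (≐-sym (∏-∷ʳ pre R)) (·-orthogonal orth (isFactor⇒orthogonal factor))

    quotient-is-R : ∏ pre ᵀ · ∏ (pre ++ R ∷ []) ≐ R
    quotient-is-R = ≐-trans (·-cong (≐-refl {A = ∏ pre ᵀ}) (∏-∷ʳ pre R))
      (≐-trans (≐-sym (·-assoc (∏ pre ᵀ) (∏ pre) R))
      (≐-trans (·-cong {B = R} (Orthogonal.gram orth) ≐-refl) (·-identityˡ R)))

    clash : Circular (∏ (pre ++ R ∷ [])) → ⊥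
    clash circular = circular⇒¬decomposable {∏ pre} {∏ (pre ++ R ∷ [])} {R} permuting orth′ circular
        quotient-is-R (IsFactor.decomposable factor)

    continue : ∀ post → factors ≡ pre ++ R ∷ post → All IsFactor post → ⊥
    -- The full product is not a proper prefix, so `adjacency` is silent here; being R₁₀, it is
    -- circular.
    continue [] split _ = clash λ i → let c , eq = R₁₀-circular i in c , λ r → trans (sym (R₁₀≐ r c)) (eq r)
      where
      R₁₀≐ : R₁₀ ≐ ∏ (pre ++ R ∷ [])
      R₁₀≐ = subst (λ l → R₁₀ ≐ ∏ l) split product
    continue (R′ ∷ post) split isFactor = [ walk (pre ++ R ∷ [])
        (R′ ∷ post) split′ isFactor orth′ , clash ]′
      (step pre R R′ post split′ orth′)
      where
      split′ : factors ≡ (pre ++ R ∷ []) ++ R′ ∷ post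
      split′ = trans split (sym (List.++-assoc pre (R ∷ []) (R′ ∷ post)))

-- Inequivalence of the representatives

I-permute : ∀ (π : Permutation′ n) i j → I (π ⟨$⟩ʳ i) (π ⟨$⟩ʳ j) ≡ I i j
I-permute π i j with i ≟ j
... | yes refl = I-diag (π ⟨$⟩ʳ i)
... | no i≢j = I-off λ eq → i≢j (trans (sym (Perm.inverseˡ π))
    (trans (cong (π ⟨$⟩ˡ_) eq) (Perm.inverseˡ π)))

permuted-entry : ∀ (π π′ : Permutation′ n) (A : Matrix n n) i j →
  (permutationMatrix π ᵀ · A · permutationMatrix π′) (π ⟨$⟩ʳ i) (π′ ⟨$⟩ʳ j) ≡ A i j
permuted-entry π π′ A i j = begin
  sum (λ l → sum (λ k → I (π ⟨$⟩ʳ k) (π ⟨$⟩ʳ i) * A k l) * I (π′ ⟨$⟩ʳ l) (π′ ⟨$⟩ʳ j))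
    ≡⟨ sum-cong-≗ (λ l → cong₂ _*_ (trans (sum-cong-≗ λ k → cong (_* A k l)
        (trans (I-permute π k i) (I-sym k i))) (sum-select i λ k → A k l))
                                   (I-permute π′ l j)) ⟩
  sum (λ l → A i l * I l j)
    ≡⟨ ·-identityʳ A i j ⟩
  A i j ∎

SameSupport : Fin 10 → Fin 10 → Set
SameSupport r s = ∀ j → (R₁₀ r j ≡ 0ℚ → R₁₀ s j ≡ 0ℚ) × (R₁₀ s j ≡ 0ℚ → R₁₀ r j ≡ 0ℚ)

Meeting : Fin 10 → Fin 10 → Set
Meeting r s = ∃[ j ] R₁₀ r j ≢ 0ℚ × R₁₀ s j ≢ 0ℚ

-- With `true` the comparison goes to the opposite corner of a block, where flat and twisted blocks
-- agree. With `false` it stays in the same column, where flat blocks agree and twisted ones do not.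
Related : Bool → Fin 10 → Fin 10 → Set
Related true  s t = s ≢ t
Related false s t = s ≡ t

-- For rows r, r′ in one block and s, t in a block adjacent to it, described in
-- terms of the supports of the rows of R₁₀ alone, so that every automorphism
-- of R₁₀ preserves the relation.
record Linked (w : Bool) (r s r′ t : Fin 10) : Set where
  constructor linked
  field
    support₁ : SameSupport r r′
    support₂ : SameSupport s t
    meeting  : Meeting r s
    separate : ¬ SameSupport r s
    distinct : r ≢ r′
    related  : Related w s t

private
  sameSupport? : ∀ r s → Dec (SameSupport r s)
  sameSupport? r s = all? λ j → ((R₁₀ r j ℚ.≟ 0ℚ) →-dec (R₁₀ s j ℚ.≟ 0ℚ)) ×-dec
      ((R₁₀ s j ℚ.≟ 0ℚ) →-dec (R₁₀ r j ℚ.≟ 0ℚ))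

  meeting? : ∀ r s → Dec (Meeting r s)
  meeting? r s = any? λ j → ¬? (R₁₀ r j ℚ.≟ 0ℚ) ×-dec ¬? (R₁₀ s j ℚ.≟ 0ℚ)

  related? : ∀ w s t → Dec (Related w s t)
  related? true  s t = ¬? (s ≟ t)
  related? false s t = s ≟ t

  Adjacent : Fin 10 → Fin 10 → Set
  Adjacent r s = block s ≡ next (block r) ⊎ block r ≡ next (block s)

  adjacent? : ∀ r s → Dec (Adjacent r s)
  adjacent? r s = (block s ≟ next (block r)) ⊎-dec (block r ≟ next (block s))

  opaque
    sameSupport⇒block : ∀ r s → SameSupport r s → block r ≡ block s
    sameSupport⇒block = toWitness {a? = all? λ r → all? λ s → sameSupport? r s →-dec
        (block r ≟ block s)} tt

    block⇒sameSupport : ∀ r s → block r ≡ block s → SameSupport r s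
    block⇒sameSupport = toWitness {a? = all? λ r → all? λ s → (block r ≟ block s) →-dec
        sameSupport? r s} tt

    meeting⇒adjacent : ∀ r s → Meeting r s → block r ≡ block s ⊎ Adjacent r s
    meeting⇒adjacent = toWitness {a? = all? λ r → all? λ s → meeting? r s →-dec
        ((block r ≟ block s) ⊎-dec adjacent? r s)} tt

-- Concordant true says that the blocks between adjacent indices are flat or
-- twisted, which separates the first two representatives from the third;
-- Concordant false separates the first from the second.
Concordant : Bool → Matrix 10 10 → Set
Concordant w B = ∀ r s r′ t → Linked w r s r′ t → B r s ≡ B r′ t

module _ (π π′ : Permutation′ 10) (invariant : ∀ i j → R₁₀ i j ≡ R₁₀ (π ⟨$⟩ʳ i) (π′ ⟨$⟩ʳ j)) where
  private
    sameSupport-permute : ∀ {r s} → SameSupport r s → SameSupport (π ⟨$⟩ʳ r) (π ⟨$⟩ʳ s)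
    sameSupport-permute {r} {s} same j =
      (λ eq → trans (at s) (proj₁ (same (π′ ⟨$⟩ˡ j)) (trans (sym (at r)) eq))) ,
      (λ eq → trans (at r) (proj₂ (same (π′ ⟨$⟩ˡ j)) (trans (sym (at s)) eq)))
      where
      at : ∀ i → R₁₀ (π ⟨$⟩ʳ i) j ≡ R₁₀ i (π′ ⟨$⟩ˡ j)
      at i = sym (trans (invariant i (π′ ⟨$⟩ˡ j)) (cong (R₁₀ (π ⟨$⟩ʳ i)) (Perm.inverseʳ π′)))

    injective : ∀ {r s} → π ⟨$⟩ʳ r ≡ π ⟨$⟩ʳ s → r ≡ s
    injective eq = trans (sym (Perm.inverseˡ π)) (trans (cong (π ⟨$⟩ˡ_) eq) (Perm.inverseˡ π))

    related-permute : ∀ w {s t} → Related w s t → Related w (π ⟨$⟩ʳ s) (π ⟨$⟩ʳ t)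
    related-permute true  s≢t eq = s≢t (injective eq)
    related-permute false s≡t = cong (π ⟨$⟩ʳ_) s≡t

    unpermute : ∀ {r s} → SameSupport (π ⟨$⟩ʳ r) (π ⟨$⟩ʳ s) → SameSupport r s
    unpermute {r} {s} same j =
      (λ eq → trans (invariant s j) (proj₁ (same (π′ ⟨$⟩ʳ j)) (trans (sym (invariant r j)) eq))) ,
      (λ eq → trans (invariant r j) (proj₂ (same (π′ ⟨$⟩ʳ j)) (trans (sym (invariant s j)) eq)))

  linked-permute : ∀ {w r s r′ t} → Linked w r s r′ t → Linked w (π ⟨$⟩ʳ r) (π ⟨$⟩ʳ s) (π ⟨$⟩ʳ r′)
      (π ⟨$⟩ʳ t)
  linked-permute {w} {r} {s} (linked p q (j , Rr≢0 , Rs≢0) sep r≢r′ rel) = linked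
    (sameSupport-permute p) (sameSupport-permute q)
    (π′ ⟨$⟩ʳ j , (λ eq → Rr≢0 (trans (invariant r j) eq)) , λ eq → Rs≢0 (trans (invariant s j) eq))
    (sep ∘ unpermute) (r≢r′ ∘ injective) (related-permute w rel)

linked-blocks : ∀ {w r s r′ t} → Linked w r s r′ t → block r ≡ block r′ × block s ≡ block t ×
    block r ≢ block s
linked-blocks {w} {r} {s} {r′} {t} (linked p q _ sep _ _) =
  sameSupport⇒block r r′ p , sameSupport⇒block s t q , λ eq → sep (block⇒sameSupport r s eq)

Invariant : Bool → Matrix 10 10 → Matrix 10 10 → Set
Invariant w B B′ = (Concordant w B → Concordant w B′) × (Concordant w B′ → Concordant w B)

-- Linked positions lie in the same off-diagonal block, so a change that depends only on the block
-- preserves equality of the two entries. Being an involution, it also reflects it.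
blockwise-invariant : ∀ w {B B′ : Matrix 10 10} (φ : Fin 5 → Fin 5 → ℚ → ℚ) →
    (∀ i j x → φ i j (φ i j x) ≡ x) →
  (∀ r s → block r ≢ block s → B′ r s ≡ φ (block r) (block s) (B r s)) → Invariant w B B′
blockwise-invariant w {B} {B′} φ involutive B′≡ = forward B B′ B′≡ ,
  forward B′ B λ r s r≢s → sym (trans (cong (φ (block r) (block s)) (B′≡ r s r≢s))
      (involutive (block r) (block s) (B r s)))
  where
  forward : ∀ (B B′ : Matrix 10 10) → (∀ r s → block r ≢ block s → B′ r s ≡ φ (block r) (block s)
      (B r s)) → Concordant w B → Concordant w B′
  forward B B′ B′≡ aligned r s r′ t link = let r≡r′ , s≡t , r≢s = linked-blocks link in begin
    B′ r s                            ≡⟨ B′≡ r s r≢s ⟩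
    φ (block r) (block s) (B r s)     ≡⟨ cong (φ (block r) (block s)) (aligned r s r′ t link) ⟩
    φ (block r) (block s) (B r′ t)    ≡⟨ cong₂ (λ i j → φ i j (B r′ t)) r≡r′ s≡t ⟩
    φ (block r′) (block t) (B r′ t)   ≡⟨ B′≡ r′ t (λ eq → r≢s (trans r≡r′ (trans eq (sym s≡t)))) ⟨
    B′ r′ t ∎

complement-involutive : ∀ x → 1ℚ - (1ℚ - x) ≡ x
complement-involutive = solve 1 (λ x → con 1ℚ :- (con 1ℚ :- x) := x) refl

move-invariant : ∀ w {B B′} → Move B B′ → Invariant w B B′
move-invariant w {B} {B′} (complement B′≐) = blockwise-invariant w {B} {B′} (λ _ _ x → 1ℚ - x)
    (λ _ _ → complement-involutive)
  λ r s r≢s → trans (B′≐ r s) (cong (λ x → 1ℚ - x - B r s) (I-off {i = r} {s} (r≢s ∘ cong block)))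
move-invariant w {B} {B′} (blockComplement i j i≢j B′≐) = blockwise-invariant w {B} {B′}
  (λ k l → apply (touched k l)) (λ k l → involutive (touched k l)) λ r s _ → B′≐ r s
  where
  touched : Fin 5 → Fin 5 → Bool
  touched k l = (does (k ≟ i) ∧ does (l ≟ j)) ∨ (does (k ≟ j) ∧ does (l ≟ i))
  apply : Bool → ℚ → ℚ
  apply b x = if b then 1ℚ - x else x
  involutive : ∀ b x → apply b (apply b x) ≡ x
  involutive true  x = complement-involutive x
  involutive false x = refl
move-invariant w {B} {B′} (conjugation π π′ automorphism B′≐) =
  (λ aligned r s r′ t link → trans (backward r s) (trans
    (aligned _ _ _ _ (linked-permute (Perm.flip π) (Perm.flip π′) inverse-invariant link))
        (sym (backward r′ t)))) ,
  (λ aligned r s r′ t link → trans (sym (forward r s)) (trans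
    (aligned _ _ _ _ (linked-permute π π′ invariant link)) (forward r′ t)))
  where
  forward : ∀ r s → B′ (π ⟨$⟩ʳ r) (π ⟨$⟩ʳ s) ≡ B r s
  forward r s = trans (B′≐ (π ⟨$⟩ʳ r) (π ⟨$⟩ʳ s)) (permuted-entry π π B r s)
  backward : ∀ r s → B′ r s ≡ B (π ⟨$⟩ˡ r) (π ⟨$⟩ˡ s)
  backward r s = trans (cong₂ B′ (sym (Perm.inverseʳ π)) (sym (Perm.inverseʳ π)))
      (forward (π ⟨$⟩ˡ r) (π ⟨$⟩ˡ s))
  invariant : ∀ i j → R₁₀ i j ≡ R₁₀ (π ⟨$⟩ʳ i) (π′ ⟨$⟩ʳ j)
  invariant i j = trans (sym (permuted-entry π π′ R₁₀ i j)) (automorphism (π ⟨$⟩ʳ i) (π′ ⟨$⟩ʳ j))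
  inverse-invariant : ∀ i j → R₁₀ i j ≡ R₁₀ (π ⟨$⟩ˡ i) (π′ ⟨$⟩ˡ j)
  inverse-invariant i j = sym (trans (invariant (π ⟨$⟩ˡ i) (π′ ⟨$⟩ˡ j))
      (cong₂ R₁₀ (Perm.inverseʳ π) (Perm.inverseʳ π′)))

∼-invariant : ∀ w {B B′ : ∃ (𝓑 R₁₀)} → B ∼ B′ → Invariant w (proj₁ B) (proj₁ B′)
∼-invariant w ε = id , id
∼-invariant w (_◅_ {j = B″} (fwd m) rest) =
  (proj₁ (∼-invariant w rest) ∘ proj₁ (move-invariant w m)) ,
      (proj₂ (move-invariant w m) ∘ proj₂ (∼-invariant w rest))
∼-invariant w (bwd m ◅ rest) =
  (proj₁ (∼-invariant w rest) ∘ proj₂ (move-invariant w m)) ,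
      (proj₁ (move-invariant w m) ∘ proj₂ (∼-invariant w rest))

private
  ConcordantOnBlocks : Bool → Matrix 10 10 → Set
  ConcordantOnBlocks w B = ∀ r s → Adjacent r s → ∀ r′ → block r ≡ block r′ → r ≢ r′ → ∀ t → block s ≡
      block t → Related w s t → B r s ≡ B r′ t

  concordantOnBlocks? : ∀ w B → Dec (ConcordantOnBlocks w B)
  concordantOnBlocks? w B = all? λ r → all? λ s → adjacent? r s →-dec
    (all? λ r′ → (block r ≟ block r′) →-dec (¬? (r ≟ r′) →-dec
    (all? λ t → (block s ≟ block t) →-dec (related? w s t →-dec (B r s ℚ.≟ B r′ t)))))

  concordantOnBlocks⇒concordant : ∀ {w B} → ConcordantOnBlocks w B → Concordant w B
  concordantOnBlocks⇒concordant {w} {B} aligned r s r′ t link@(linked _ _ meets _ r≢r′ rel) =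
    let r≡r′ , s≡t , r≢s = linked-blocks link in
    aligned r s ([ (λ eq → contradiction eq r≢s) , id ]′ (meeting⇒adjacent r s meets)) r′ r≡r′ r≢r′ t
        s≡t rel

  linked? : ∀ w r s r′ t → Dec (Linked w r s r′ t)
  linked? w r s r′ t = map′ (λ (p , q , m , sep , d , rel) → linked p q m sep d rel)
    (λ (linked p q m sep d rel) → p , q , m , sep , d , rel)
    (sameSupport? r r′ ×-dec sameSupport? s t ×-dec meeting? r s ×-dec ¬? (sameSupport? r s) ×-dec ¬?
        (r ≟ r′) ×-dec related? w s t)

  opaque
    concordant-00 : Concordant true (representative 0F)
    concordant-00 = concordantOnBlocks⇒concordant {true}
        (toWitness {a? = concordantOnBlocks? true (representative 0F)} tt)

    concordant-01 : Concordant false (representative 0F)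
    concordant-01 = concordantOnBlocks⇒concordant {false}
        (toWitness {a? = concordantOnBlocks? false (representative 0F)} tt)

    concordant-10 : Concordant true (representative 1F)
    concordant-10 = concordantOnBlocks⇒concordant {true}
        (toWitness {a? = concordantOnBlocks? true (representative 1F)} tt)

    ¬concordant-11 : ¬ Concordant false (representative 1F)
    -- Block (0 , 1) is I, whose first column is not constant.
    ¬concordant-11 aligned = contradiction
      (aligned 0F 2F 1F 2F (toWitness {a? = linked? false 0F 2F 1F 2F} tt)) λ ()

    ¬concordant-20 : ¬ Concordant true (representative 2F)
    -- Block (0 , 1) is `N`, whose two diagonal entries differ.
    ¬concordant-20 aligned = contradiction
      (aligned 0F 2F 1F 3F (toWitness {a? = linked? true 0F 2F 1F 3F} tt)) λ ()

inequivalent : ∀ k l → (∀ w → Invariant w (representative k) (representative l)) → k ≡ l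
inequivalent 0F 0F _ = refl
inequivalent 0F 1F i = contradiction (proj₁ (i false) concordant-01) ¬concordant-11
inequivalent 0F 2F i = contradiction (proj₁ (i true) concordant-00) ¬concordant-20
inequivalent 1F 0F i = contradiction (proj₂ (i false) concordant-01) ¬concordant-11
inequivalent 1F 1F _ = refl
inequivalent 1F 2F i = contradiction (proj₁ (i true) concordant-10) ¬concordant-20
inequivalent 2F 0F i = contradiction (proj₂ (i true) concordant-00) ¬concordant-20
inequivalent 2F 1F i = contradiction (proj₂ (i true) concordant-10) ¬concordant-20
inequivalent 2F 2F _ = refl

theorem22 : Σ[ rep∈𝓑 ∈ (∀ k → 𝓑 R₁₀ (representative k)) ]
    (∀ k → Irreducible R₁₀ (representative k)) ×
    (∀ k l → (representative k , rep∈𝓑 k) ∼ (representative l , rep∈𝓑 l) → k ≡ l) ×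
    (∀ (B : ∃ (𝓑 R₁₀)) → Irreducible R₁₀ (proj₁ B) →
    ∃[ k ] B ∼ (representative k , rep∈𝓑 k))
theorem22 = representative∈𝓑 , representative-irreducible ,
  (λ k l k∼l → inequivalent k l λ w → ∼-invariant w k∼l) , irreducible⇒equivalent
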